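{- Let $n\ge 2$ and let $\frac{a}{b}$ (in lowest terms) be a term of the Farey sequence for $n$ with $0<\frac{a}{b}<1$. Let $w_1<w_2<\dots<w_k=\frac{a}{b}$ be all terms of the Farey sequence for $n$ lying in the interval $(0,\frac{a}{b}]$, and let $d_i$ be the denominator of $w_i$ in lowest terms. Define partitions of $n$ by $\lambda_0=(n)$ (the trivial representation) and $\lambda_i=\big(M_{d_i}(\lambda_{i-1})\big)^t$ for $i=1,\dots,k$. Then the Young diagram of $\lambda_k$ is exactly the set of the $n$ smallest boxes (among all boxes $(x,y)$ with $x\ge1$, $y\le -1$ integers) with respect to the total order $>_{a,b}$.
   Context: The Farey sequence for $n$ is the increasing sequence of all rational numbers in $[0,1]$ whose denominator (in lowest terms) is at most $n$. Young diagrams are drawn in the fourth quadrant in English convention; the box in column $i\ge1$ and row $j\ge1$ has coordinates $(x,y)=(i,-j)$. For integers $0<a<b$, the order $>_{a,b}$ on integer pairs is defined by $(x_1,y_1)>_{a,b}(x_2,y_2)$ if either $ax_1-(b-a)y_1>ax_2-(b-a)y_2$, or $ax_1-(b-a)y_1=ax_2-(b-a)y_2$ and $y_1>y_2$. For an integer $d\ge2$, $M_d$ denotes the Mullineux involution with base $d$ on partitions of $n$ (the $d$-Mullineux involution on $d$-regular partitions), and $\mu^t$ denotes the transposed (conjugate) partition of $\mu$. The operation $\mu\mapsto M_{d}(\mu)^t$ is called wall-crossing across the wall of denominator $d$. -}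

module Defs where

open import Data.Nat using (ℕ; zero; suc; _+_; _*_; _∸_; _≤_; _<_; _⊓_; _≡ᵇ_; _<ᵇ_; _≤ᵇ_)
open import Data.Nat.Properties using (_≟_; _≤?_)
open import Data.Nat.Divisibility using (_∣?_)
open import Data.Sum using (_⊎_)
open import Data.Bool using (Bool; true; false; if_then_else_; _∧_; not; T)
open import Relation.Nullary.Decidable using (T?)
open import Data.List using (List; []; _∷_; length; map; concatMap; filter; upTo; reverse; foldr)
open import Data.Nat.ListAction using (sum)
import Data.List.Properties
open import Data.Maybe using (Maybe; just; nothing; _>>=_)
open import Data.Product using (_×_; _,_)
import Data.Product.Properties
open import Relation.Nullary.Decidable using (⌊_⌋; Dec; yes; no)
open import Relation.Binary.PropositionalEquality using (_≡_; refl)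

-- Partitions are lists of parts λ₁ ≥ λ₂ ≥ … > 0 (English convention).

-- Box in column i ≥ 1 and row j ≥ 1 (i.e. coordinates (x,y) = (i,-j))
-- belongs to the Young diagram of lam iff j ≤ ℓ(lam) and i ≤ λ_j.
rowLength : List ℕ → ℕ → ℕ
rowLength []       _             = 0
rowLength (p ∷ ps) zero          = 0
rowLength (p ∷ ps) (suc zero)    = p
rowLength (p ∷ ps) (suc (suc j)) = rowLength ps (suc j)

InDiagram : List ℕ → ℕ → ℕ → Set
InDiagram lam i j = 1 ≤ i × 1 ≤ j × i ≤ rowLength lam j

countGE : ℕ → List ℕ → ℕ
countGE j []       = 0
countGE j (p ∷ ps) = (if j ≤ᵇ p then 1 else 0) + countGE j ps

firstPart : List ℕ → ℕ
firstPart []      = 0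
firstPart (p ∷ _) = p

transpose : List ℕ → List ℕ
transpose lam = map (λ j → countGE j lam) (map suc (upTo (firstPart lam)))

partsGo : ℕ → ℕ → ℕ → List (List ℕ)
partsGo _        zero    _ = [] ∷ []
partsGo zero     (suc n) _ = []
partsGo (suc f)  (suc n) m =
  concatMap (λ p → map (p ∷_) (partsGo f (suc n ∸ p) p))
            (map suc (upTo (suc n ⊓ m)))

partitionsOf : ℕ → List (List ℕ)
partitionsOf n = partsGo n n n

countEq : ℕ → List ℕ → ℕ
countEq x []       = 0
countEq x (p ∷ ps) = (if x ≡ᵇ p then 1 else 0) + countEq x ps

isRegular : ℕ → List ℕ → Bool
isRegular d lam = foldr (λ p r → (countEq p lam <ᵇ d) ∧ r) true lam

-- Mullineux's algorithm (removal of d-rims).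
-- The rim boxes of row i are the columns λ_{i+1} … λ_i (columns 1 … λ_r in
-- the last row r); the rim is traversed from (row 1, column λ₁) down-left.
-- The d-rim is a union of d-segments: each segment consists of d
-- consecutive rim boxes (the final one may be shorter); the first starts
-- at the rightmost rim box of row 1, and each subsequent one starts at the
-- rightmost rim box of the row just below the row where the previous
-- segment ended.  `rimGo k λ` processes the rows, where k is the number of
-- boxes the current segment may still take (k = d when a new segment
-- starts at this row); it returns the new row lengths and the number of
-- removed boxes.

rimLen : ℕ → List ℕ → ℕ
rimLen p []      = p
rimLen p (q ∷ _) = suc (p ∸ q)

rimGo : ℕ → ℕ → List ℕ → List ℕ × ℕ
rimGo d k []       = [] , 0
rimGo d k (p ∷ ps) with k ⊓ rimLen p ps
... | m with rimGo d (if m ≡ᵇ k then d else k ∸ m) ps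
...   | rest , tot = (p ∸ m) ∷ rest , m + tot

dropZeros : List ℕ → List ℕ
dropZeros = filter (λ x → 1 ≤? x)

mullineuxSymbolGo : ℕ → ℕ → List ℕ → List (ℕ × ℕ)
mullineuxSymbolGo d zero    lam = []
mullineuxSymbolGo d (suc f) [] = []
mullineuxSymbolGo d (suc f) lam@(_ ∷ _) with rimGo d d lam
... | lam' , A = (A , length lam) ∷ mullineuxSymbolGo d f (dropZeros lam')

mullineuxSymbol : ℕ → List ℕ → List (ℕ × ℕ)
mullineuxSymbol d lam = mullineuxSymbolGo d (sum lam) lam

divisibleᵇ : ℕ → ℕ → Bool
divisibleᵇ d A = ⌊ d ∣? A ⌋

mullineuxColumn : ℕ → ℕ × ℕ → ℕ × ℕ
mullineuxColumn d (A , r) = A , ((A ∸ r) + (if divisibleᵇ d A then 0 else 1))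

symbolEqᵇ : List (ℕ × ℕ) → List (ℕ × ℕ) → Bool
symbolEqᵇ s t = ⌊ Data.List.Properties.≡-dec (Data.Product.Properties.≡-dec _≟_ _≟_) s t ⌋

headMaybe : {A : Set} → List A → Maybe A
headMaybe []      = nothing
headMaybe (x ∷ _) = just x

-- M_d(lam): defined on d-regular λ; it is the d-regular partition of |λ|
-- whose Mullineux symbol is obtained from that of lam by Mullineux's rule.
-- Returns `nothing` if lam is not d-regular (or no such partition exists).
mullineux : ℕ → List ℕ → Maybe (List ℕ)
mullineux d lam =
  if isRegular d lam
  then headMaybe (filter (λ μ → T? (isRegular d μ ∧ symbolEqᵇ (mullineuxSymbol d μ) target))
                         (partitionsOf (sum lam)))
  else nothing
  where
  target = map (mullineuxColumn d) (mullineuxSymbol d lam)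

wallCross : ℕ → List ℕ → Maybe (List ℕ)
wallCross d μ = mullineux d μ >>= λ ν → just (transpose ν)

wallCrossAll : List ℕ → List ℕ → Maybe (List ℕ)
wallCrossAll []       lam = just lam
wallCrossAll (d ∷ ds) lam = wallCross d lam >>= wallCrossAll ds

-- The order >_{a,b}: for box (x,y) = (i,-j),  a x - (b-a) y = a i + (b-a) j.
-- `BoxLt a b (i , j) (i' , j')` means (i,-j) <_{a,b} (i',-j').
boxValue : ℕ → ℕ → ℕ → ℕ → ℕ
boxValue a b i j = a * i + (b ∸ a) * j

BoxLt : ℕ → ℕ → ℕ → ℕ → ℕ → ℕ → Set
BoxLt a b i j i' j' =
  boxValue a b i j < boxValue a b i' j'
  ⊎ (boxValue a b i j ≡ boxValue a b i' j' × j' < j)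

private
  test1 : wallCrossAll (3 ∷ 2 ∷ []) (3 ∷ []) ≡ just (2 ∷ 1 ∷ [])
  test1 = refl
  test2 : wallCrossAll (5 ∷ 4 ∷ 3 ∷ 5 ∷ 2 ∷ []) (5 ∷ []) ≡ just (2 ∷ 2 ∷ 1 ∷ [])
  test2 = refl

{-# OPTIONS --safe #-}
-- Write e = a, f = b - a and d = b. Just before the wall a/b the n smallest boxes form a diagram λ
-- consisting of the boxes with e i + f j < M and of the t top boxes of the line e i + f j = M; just
-- after it the t bottom boxes of this line are taken instead, giving μ. Values are congruent to
-- e (i - j) modulo d, so the residues met by a segment of d consecutive rim boxes are all different,
-- and removing the d-rim turns M into M - d while keeping t. Transposing μ gives a diagram of the same
-- kind with e and f exchanged, so the columns of the two Mullineux symbols can be compared step by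
-- step: the sum of the lengths of the first row of μ and of the first column of λ exceeds the size of
-- the d-rim by 1, except when the line meets both borders and all but one of its boxes belong to the
-- diagrams, and exactly then d divides that size. As a partition is determined by its symbol, μ is the
-- transpose of M_d(λ). Between two consecutive walls the set of n smallest boxes does not change,
-- because two boxes exchanging their order there do so at a fraction of denominator at most n.
module Submission where

open import Defs

-- `mullineux` searches all partitions for one with a prescribed symbol, so its value is identified
-- by naming a candidate and proving that the search can find nothing else. The symbol is injective
-- because a rim removal can be read from the last row upwards: modulo `d`, the boxes removed from a
-- row and the room left after it determine the room before it. The number t survives a removal for
-- the following reason. What remains is the old diagram moved one step along the diagonal, which
-- drops the box of the line in row 0, if there is one. In that case one rim box is skipped, and it
-- takes the place of the first missing box of the line, unless that box lies in column 0. The line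
-- itself gets shorter whenever it meets a border; once it has at most t boxes, both diagrams
-- contain all of them and the tie rules no longer matter.

module WallCrossing where

  open import Data.Bool using (true; false; if_then_else_; _∧_; T)
  open import Data.Bool.Properties using (T-∧; T-≡)
  open import Data.Empty using (⊥; ⊥-elim)
  open import Data.Integer as ℤ using (∣_∣)
  import Data.Integer.Properties as ℤ
  open import Data.List using (List; []; _∷_; length; map; filter; foldr; upTo; applyUpTo)
  open import Data.List.Membership.Propositional using (_∈_; find; lose)
  open import Data.List.Membership.Propositional.Properties using (∈-map⁺; ∈-map⁻; ∈-concatMap⁺; ∈-concatMap⁻; ∈-upTo⁺; ∈-upTo⁻)
  open import Data.List.Properties using (∷-injective; map-upTo; map-applyUpTo; length-applyUpTo)
  open import Data.List.Relation.Unary.All as All using (All)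
  open import Data.List.Relation.Unary.Any using (here; there)
  open import Data.List.Relation.Unary.Linked as Linked using (Linked)
  open import Data.List.Relation.Unary.Linked.Properties using (Linked⇒All)
  open import Data.Maybe using (just; _>>=_)
  open import Data.Nat using (ℕ; zero; suc; _+_; _*_; _∸_; _≤_; _<_; _⊓_; _≡ᵇ_; _<ᵇ_; _≤ᵇ_; z≤n; s≤s; s≤s⁻¹; >-nonZero; _%_; _/_)
  open import Data.Nat.Coprimality as Coprimality using (Coprime; coprime-divisor)
  open import Data.Nat.DivMod using (m≡m%n+[m/n]*n; m%n<n; m≥n⇒m/n>0)
  open import Data.Nat.Divisibility using (_∣_; divides; ∣m+n∣m⇒∣n; >⇒∤; m∣m*n; _∣?_; ∣m∣n⇒∣m+n)
  import Data.Nat.GCD as GCD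
  open import Data.Nat.ListAction using (sum)
  open import Data.Nat.Properties
  open import Data.Nat.Tactic.RingSolver using (solve; solve-∀)
  open import Data.Product using (∃; ∃-syntax; _×_; _,_; proj₁; proj₂)
  open import Data.Rational as ℚ using (ℚ; mkℚ; 0ℚ; 1ℚ; ↥_; ↧_; ↧ₙ_)
  import Data.Rational.Properties as ℚ
  open import Data.Sum using (_⊎_; inj₁; inj₂)
  open import Function.Bundles using (_⇔_; Equivalence)
  open import Relation.Binary using (tri<; tri≈; tri>)
  open import Relation.Binary.PropositionalEquality using (_≡_; _≢_; refl; sym; trans; cong; cong₂; subst; subst₂)
  open import Relation.Nullary using (¬_; Dec; yes; no)
  open import Relation.Nullary.Decidable using (toWitness; fromWitness)

  -- Linear certificates and congruences

  infixl 6 _⊕_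
  infixl 7 _⊛_

  _⊕_ : ∀ {a b c d} → a ≤ b → c ≤ d → a + c ≤ b + d
  _⊕_ = +-mono-≤

  _⊛_ : ∀ {a b} c → a ≤ b → c * a ≤ c * b
  c ⊛ p = *-monoʳ-≤ c p

  eq≤ : ∀ {a b} → a ≡ b → a ≤ b
  eq≤ = ≤-reflexive

  eq≥ : ∀ {a b} → a ≡ b → b ≤ a
  eq≥ p = ≤-reflexive (sym p)

  -- A Farkas certificate: the combined inequality a ≤ b is contradictory when a exceeds b.
  -- It is abstract so that the proof by the ring solver is never evaluated.
  abstract
    absurd : ∀ {a b} s → a ≤ b → a ≡ suc (b + s) → ⊥
    absurd {b = b} s p a≡ = <-irrefl refl (≤-trans (s≤s (m≤m+n b s)) (≤-trans (eq≥ a≡) p))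

  abstract
    cert : ∀ {x y a b} s → a ≤ b → y + a ≡ x + b + s → x ≤ y
    cert {x} {y} {a} {b} s h e = +-cancelʳ-≤ a x y (≤-trans (≤-trans (+-monoʳ-≤ x h) (m≤m+n (x + b) s)) (eq≥ e))

  infixl 6 _⊞_
  infixl 7 _⊠_

  _⊞_ : ∀ {a b c d : ℕ} → a ≡ b → c ≡ d → a + c ≡ b + d
  _⊞_ = cong₂ _+_

  _⊠_ : ∀ {a b : ℕ} c → a ≡ b → c * a ≡ c * b
  c ⊠ p = cong (c *_) p

  abstract
    lineq : ∀ {x y a b : ℕ} → a ≡ b → x + b ≡ y + a → x ≡ y
    lineq {x} {y} {a} refl q = +-cancelʳ-≡ a x y q

  -- A congruence modulo `b` is an equation with a multiple of `b` on each side, which avoids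
  -- subtraction. If `p ≤ q` the equation gives `w ≤ u`, otherwise it gives `u + b ≤ w`.
  noCong : ∀ b p q {u w} → u + b * p ≡ w + b * q → u < w → w < u + b → ⊥
  noCong b p q {u} {w} h u<w w<u+b with p ≤? q
  ... | yes p≤q = absurd 0 (eq≥ h ⊕ b ⊛ p≤q ⊕ u<w) (solve (u ∷ w ∷ b ∷ p ∷ q ∷ []))
  ... | no p≰q = absurd 0 (eq≤ h ⊕ b ⊛ ≰⇒> p≰q ⊕ w<u+b) (solve (u ∷ w ∷ b ∷ p ∷ q ∷ []))

  uniqueRep : ∀ {d k k′ x y} → 1 ≤ k → k ≤ d → 1 ≤ k′ → k′ ≤ d → k + d * x ≡ k′ + d * y → k ≡ k′
  uniqueRep {d} {k} {k′} {x} {y} k≥1 k≤d k′≥1 k′≤d h with <-cmp k k′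
  ... | tri≈ _ k≡k′ _ = k≡k′
  ... | tri< k<k′ _ _ = ⊥-elim (noCong d x y h k<k′ (≤-trans (s≤s k′≤d) (+-monoˡ-≤ d k≥1)))
  ... | tri> _ _ k′<k = ⊥-elim (noCong d y x (sym h) k′<k (≤-trans (s≤s k≤d) (+-monoˡ-≤ d k′≥1)))

  -- Injectivity of the Mullineux symbol

  data Partition : List ℕ → Set where
    none : Partition []
    one  : ∀ {p} → 1 ≤ p → Partition (p ∷ [])
    cons : ∀ {p q ps} → q ≤ p → Partition (q ∷ ps) → Partition (p ∷ q ∷ ps)

  Partition-tail : ∀ {p ps} → Partition (p ∷ ps) → Partition ps
  Partition-tail (one _)    = none
  Partition-tail (cons _ π) = π

  Partition-head : ∀ {p ps} → Partition (p ∷ ps) → 1 ≤ p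
  Partition-head (one p≥1)    = p≥1
  Partition-head (cons q≤p π) = ≤-trans (Partition-head π) q≤p

  nextRoom : ℕ → ℕ → ℕ → ℕ
  nextRoom d k m = if m ≡ᵇ k then d else k ∸ m

  -- One row of the rim traversal: m boxes are removed, k₁ is the room left for the next row.
  data RowStep (d k l : ℕ) : ℕ → ℕ → Set where
    closes : k ≤ l → RowStep d k l k d
    stays  : ∀ {k₁} → k ≡ l + k₁ → 1 ≤ k₁ → RowStep d k l l k₁

  ≡ᵇ-refl : ∀ n → (n ≡ᵇ n) ≡ true
  ≡ᵇ-refl zero    = refl
  ≡ᵇ-refl (suc n) = ≡ᵇ-refl n

  <⇒≡ᵇ-false : ∀ {m n} → m < n → (m ≡ᵇ n) ≡ false
  <⇒≡ᵇ-false {zero}  {suc n} _         = refl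
  <⇒≡ᵇ-false {suc m} {suc n} (s≤s m<n) = <⇒≡ᵇ-false m<n

  rowStep : ∀ d k l → RowStep d k l (k ⊓ l) (nextRoom d k (k ⊓ l))
  rowStep d k l with k ≤? l
  ... | yes k≤l rewrite m≤n⇒m⊓n≡m k≤l | ≡ᵇ-refl k = closes k≤l
  ... | no k≰l rewrite m≥n⇒m⊓n≡n (<⇒≤ (≰⇒> k≰l)) | <⇒≡ᵇ-false (≰⇒> k≰l) =
    stays (sym (m+[n∸m]≡n (<⇒≤ (≰⇒> k≰l)))) (m<n⇒0<n∸m (≰⇒> k≰l))

  RowStep-room : ∀ {d k l m k₁} → 1 ≤ k → k ≤ d → RowStep d k l m k₁ → 1 ≤ k₁ × k₁ ≤ d
  RowStep-room k≥1 k≤d (closes _)      = ≤-trans k≥1 k≤d , ≤-refl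
  RowStep-room k≥1 k≤d (stays {k₁} k≡ k₁≥1) = k₁≥1 , ≤-trans (≤-trans (m≤n+m k₁ _) (eq≥ k≡)) k≤d

  -- Removed boxes plus remaining room are invariant modulo `d`: only the opening of a new segment
  -- adds `d`.
  RowStep-sum : ∀ {d k l m k₁} → RowStep d k l m k₁ → ∃[ c ] m + k₁ ≡ k + d * c
  RowStep-sum {d} {k} (closes _) = 1 , cong (k +_) (sym (*-identityʳ d))
  RowStep-sum {d} {k} (stays k≡ _) = 0 , trans (sym k≡) (trans (sym (+-identityʳ k)) (cong (k +_) (sym (*-zeroʳ d))))

  rimRest : ℕ → ℕ → List ℕ → List ℕ
  rimRest d k ps = proj₁ (rimGo d k ps)

  rimSize : ℕ → ℕ → List ℕ → ℕ
  rimSize d k ps = proj₂ (rimGo d k ps)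

  -- Read from below, a removal determines all rows except the first, of which only the difference
  -- between its length and the room on entering it is known. For empty lists this leaves the room
  -- itself.
  SameShift : ℕ → ℕ → List ℕ → List ℕ → Set
  SameShift k k′ []       []       = k ≡ k′
  SameShift k k′ (p ∷ ps) (q ∷ qs) = ps ≡ qs × p + k′ ≡ q + k
  SameShift _ _  _        _        = ⊥

  rimLen≤ : ∀ {p ps} → Partition (p ∷ ps) → rimLen p ps ≤ p
  rimLen≤ (one _) = ≤-refl
  rimLen≤ {p} (cons {q = q} q≤p π) =
    ≤-trans (+-monoˡ-≤ (p ∸ q) (Partition-head π)) (eq≤ (m+[n∸m]≡n q≤p))

  RowStep-≤ : ∀ {d k l m k₁} → RowStep d k l m k₁ → m ≤ l
  RowStep-≤ (closes k≤l) = k≤l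
  RowStep-≤ (stays _ _)  = ≤-refl

  rim-injective-row : ∀ {d k k′ m m′ k₁ k₁′} p ps q qs → k ≤ d → k′ ≤ d →
    Partition (p ∷ ps) → Partition (q ∷ qs) →
    RowStep d k (rimLen p ps) m k₁ → RowStep d k′ (rimLen q qs) m′ k₁′ →
    ∀ {r r′} → r + m ≡ p → r′ + m′ ≡ q → r ≡ r′ → SameShift k₁ k₁′ ps qs → SameShift k k′ (p ∷ ps) (q ∷ qs)
  rim-injective-row {d} {k} {k′} p [] q [] _ _ _ _ (closes _) (closes _) {r} {r′} rp rq h _ =
    refl , lineq (sym rp ⊞ rq ⊞ h) (solve (p ∷ q ∷ k ∷ k′ ∷ r ∷ r′ ∷ []))
  rim-injective-row {d} {k} {k′} p [] q [] _ k′≤ _ (one q≥1) (closes _) (stays {k₁} k′≡ _) _ _ _ d≡k₁ =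
    ⊥-elim (clash k′≡)
    where
    clash : k′ ≡ q + k₁ → ⊥
    clash K = absurd 0 (eq≥ K ⊕ k′≤ ⊕ q≥1 ⊕ eq≤ d≡k₁) (solve (k′ ∷ q ∷ k₁ ∷ d ∷ []))
  rim-injective-row {d} {k} p [] q [] k≤ _ (one p≥1) _ (stays {k₁} k≡ _) (closes _) _ _ _ k₁≡d =
    ⊥-elim (clash k≡)
    where
    clash : k ≡ p + k₁ → ⊥
    clash K = absurd 0 (eq≥ K ⊕ k≤ ⊕ p≥1 ⊕ eq≥ k₁≡d) (solve (k ∷ p ∷ k₁ ∷ d ∷ []))
  rim-injective-row {d} {k} {k′} p [] q [] _ _ _ _ (stays {k₁} k≡ _) (stays {k₁′} k′≡ _) rp rq h k₁≡ =
    refl , shift k≡ k′≡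
    where
    shift : k ≡ p + k₁ → k′ ≡ q + k₁′ → p + k′ ≡ q + k
    shift K K′ = lineq (K′ ⊞ sym K ⊞ sym k₁≡) (solve (p ∷ q ∷ k ∷ k′ ∷ k₁ ∷ k₁′ ∷ []))
  rim-injective-row {d} {k} {k′} p (p₁ ∷ ps) q (q₁ ∷ qs) _ _ (cons a π) (cons b ρ) (closes k≤) (closes k′≤) {r} {r′} rp rq h (e , s) =
    cong₂ _∷_ (+-cancelʳ-≡ d p₁ q₁ s) e , lineq (sym rp ⊞ rq ⊞ h) (solve (p ∷ q ∷ k ∷ k′ ∷ r ∷ r′ ∷ []))
  rim-injective-row {d} {k} {k′} p (p₁ ∷ ps) q (q₁ ∷ qs) _ k′≤d (cons a π) (cons b ρ) (closes k≤) (stays {k₁′} k′≡ _) {r} {r′} rp rq h (e , s) =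
    ⊥-elim (clash (p ∸ p₁) (q ∸ q₁) (m+[n∸m]≡n a) (m+[n∸m]≡n b) k≤ k′≡ rq)
    where
    -- A row that closes keeps at least `p₁ - 1` boxes and one that stays keeps exactly `q₁ - 1`, so
    -- `p₁ ≤ q₁` and hence `d ≤ k₁′`; but a row that stays has used up part of a room of at most
    -- `d`.
    clash : ∀ u v → p₁ + u ≡ p → q₁ + v ≡ q → k ≤ suc u → k′ ≡ suc v + k₁′ → r′ + suc v ≡ q → ⊥
    clash u v P Q K K′ R = absurd v (eq≥ s ⊕ K ⊕ eq≤ P ⊕ eq≥ Q ⊕ eq≥ rp ⊕ eq≤ R ⊕ eq≤ h ⊕ eq≥ K′ ⊕ k′≤d)
      (solve (p ∷ p₁ ∷ u ∷ q ∷ q₁ ∷ v ∷ k ∷ k′ ∷ k₁′ ∷ d ∷ r ∷ r′ ∷ []))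
  rim-injective-row {d} {k} {k′} p (p₁ ∷ ps) q (q₁ ∷ qs) k≤d _ (cons a π) (cons b ρ) (stays {k₁} k≡ _) (closes k′≤) {r} {r′} rp rq h (e , s) =
    ⊥-elim (clash (p ∸ p₁) (q ∸ q₁) (m+[n∸m]≡n a) (m+[n∸m]≡n b) k≡ k′≤ rp)
    where
    clash : ∀ u v → p₁ + u ≡ p → q₁ + v ≡ q → k ≡ suc u + k₁ → k′ ≤ suc v → r + suc u ≡ p → ⊥
    clash u v P Q K K′ R = absurd u (eq≤ s ⊕ K′ ⊕ eq≥ P ⊕ eq≤ Q ⊕ eq≤ R ⊕ eq≥ rq ⊕ eq≥ h ⊕ eq≥ K ⊕ k≤d)
      (solve (p ∷ p₁ ∷ u ∷ q ∷ q₁ ∷ v ∷ k ∷ k′ ∷ k₁ ∷ d ∷ r ∷ r′ ∷ []))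
  rim-injective-row {d} {k} {k′} p (p₁ ∷ ps) q (q₁ ∷ qs) _ _ (cons a π) (cons b ρ) (stays {k₁} k≡ _) (stays {k₁′} k′≡ _) {r} {r′} rp rq h (e , s) =
    shift (p ∸ p₁) (q ∸ q₁) (m+[n∸m]≡n a) (m+[n∸m]≡n b) k≡ k′≡ rp rq
    where
    shift : ∀ u v → p₁ + u ≡ p → q₁ + v ≡ q → k ≡ suc u + k₁ → k′ ≡ suc v + k₁′ → r + suc u ≡ p → r′ + suc v ≡ q →
            p₁ ∷ ps ≡ q₁ ∷ qs × p + k′ ≡ q + k
    shift u v P Q K K′ R R′ = cong₂ _∷_ p₁≡q₁ e ,
      lineq (sym P ⊞ Q ⊞ K′ ⊞ sym K ⊞ s) (solve (p ∷ p₁ ∷ u ∷ q ∷ q₁ ∷ v ∷ k ∷ k′ ∷ k₁ ∷ k₁′ ∷ []))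
      where
      p₁≡q₁ : p₁ ≡ q₁
      p₁≡q₁ = lineq (P ⊞ sym Q ⊞ h ⊞ sym R ⊞ R′) (solve (p ∷ p₁ ∷ u ∷ q ∷ q₁ ∷ v ∷ r ∷ r′ ∷ []))

  -- The room left for the first row is known only modulo a common shift of that row, so the induction
  -- compares the removed totals modulo d.
  rim-injective : ∀ {d} k k′ ps qs → 1 ≤ k → k ≤ d → 1 ≤ k′ → k′ ≤ d → Partition ps → Partition qs →
    length ps ≡ length qs → rimRest d k ps ≡ rimRest d k′ qs →
    ∀ x y → rimSize d k ps + k′ + d * x ≡ rimSize d k′ qs + k + d * y → SameShift k k′ ps qs
  rim-injective k k′ [] [] k≥1 k≤d k′≥1 k′≤d _ _ _ _ x y tot = sym (uniqueRep k′≥1 k′≤d k≥1 k≤d tot)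
  rim-injective {d} k k′ (p ∷ ps) (q ∷ qs) k≥1 k≤d k′≥1 k′≤d π ρ len rest x y tot
    with rowStep d k (rimLen p ps) | rowStep d k′ (rimLen q qs)
  ... | s | s′ = rim-injective-row p ps q qs k≤d k′≤d π ρ s s′
      (m∸n+n≡m (≤-trans (RowStep-≤ s) (rimLen≤ π))) (m∸n+n≡m (≤-trans (RowStep-≤ s′) (rimLen≤ ρ)))
      (proj₁ (∷-injective rest))
      (rim-injective _ _ ps qs (proj₁ r) (proj₂ r) (proj₁ r′) (proj₂ r′) (Partition-tail π) (Partition-tail ρ)
        (suc-injective len) (proj₂ (∷-injective rest)) (x + proj₁ c) (y + proj₁ c′)
        (total (k ⊓ rimLen p ps) (k′ ⊓ rimLen q qs) _ _ _ _ _ _ (proj₂ c) (proj₂ c′) tot))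
    where
    r = RowStep-room k≥1 k≤d s
    r′ = RowStep-room k′≥1 k′≤d s′
    c = RowStep-sum s
    c′ = RowStep-sum s′
    total : ∀ m m′ k₁ k₁′ c c′ t t′ → m + k₁ ≡ k + d * c → m′ + k₁′ ≡ k′ + d * c′ →
            m + t + k′ + d * x ≡ m′ + t′ + k + d * y → t + k₁′ + d * (x + c) ≡ t′ + k₁ + d * (y + c′)
    total m m′ k₁ k₁′ c c′ t t′ S S′ T =
      lineq (S′ ⊞ sym S ⊞ T) (solve (m ∷ m′ ∷ k₁ ∷ k₁′ ∷ c ∷ c′ ∷ t ∷ t′ ∷ d ∷ x ∷ y ∷ k ∷ k′ ∷ []))

  at : List ℕ → ℕ → ℕ
  at lam j = rowLength lam (suc j)

  Decreasing : List ℕ → Set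
  Decreasing ps = ∀ j → at ps (suc j) ≤ at ps j

  Decreasing-≤ : ∀ ps → Decreasing ps → ∀ {i j} → i ≤ j → at ps j ≤ at ps i
  Decreasing-≤ ps δ {zero} {zero}  _ = ≤-refl
  Decreasing-≤ ps δ {i} {suc j} i≤j with m≤n⇒m<n∨m≡n i≤j
  ... | inj₁ (s≤s i≤j′) = ≤-trans (δ j) (Decreasing-≤ ps δ i≤j′)
  ... | inj₂ refl       = ≤-refl

  Partition⇒Decreasing : ∀ {ps} → Partition ps → Decreasing ps
  Partition⇒Decreasing none         j       = z≤n
  Partition⇒Decreasing (one _)      j       = z≤n
  Partition⇒Decreasing (cons q≤p π) zero    = q≤p
  Partition⇒Decreasing (cons q≤p π) (suc j) = Partition⇒Decreasing π j

  Partition-∷ : ∀ {p ps} → 1 ≤ p → at ps 0 ≤ p → Partition ps → Partition (p ∷ ps)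
  Partition-∷ {ps = []}    p≥1 _   _ = one p≥1
  Partition-∷ {ps = _ ∷ _} _   q≤p π = cons q≤p π

  at-length : ∀ {ps} → Partition ps → ∀ {j} → j < length ps → 1 ≤ at ps j
  at-length {_ ∷ _} π {zero}  _        = Partition-head π
  at-length {_ ∷ _} π {suc j} (s≤s j<) = at-length (Partition-tail π) j<

  length-at : ∀ ps {j} → 1 ≤ at ps j → j < length ps
  length-at (p ∷ ps) {zero}  _ = s≤s z≤n
  length-at (p ∷ ps) {suc j} h = s≤s (length-at ps h)

  at-injective : ∀ ps qs → length ps ≡ length qs → (∀ j → at ps j ≡ at qs j) → ps ≡ qs
  at-injective []       []       _   _ = refl
  at-injective (p ∷ ps) (q ∷ qs) len h =
    cong₂ _∷_ (h 0) (at-injective ps qs (suc-injective len) (λ j → h (suc j)))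

  dropZeros-at : ∀ ps → Decreasing ps → ∀ j → at (dropZeros ps) j ≡ at ps j
  dropZeros-at []           δ j       = refl
  dropZeros-at (zero ∷ ps)  δ j       =
    trans (dropZeros-at ps (λ i → δ (suc i)) j)
          (trans (n≤0⇒n≡0 (Decreasing-≤ (0 ∷ ps) δ {0} {suc j} z≤n)) (sym (n≤0⇒n≡0 (Decreasing-≤ (0 ∷ ps) δ {0} {j} z≤n))))
  dropZeros-at (suc p ∷ ps) δ zero    = refl
  dropZeros-at (suc p ∷ ps) δ (suc j) = dropZeros-at ps (λ i → δ (suc i)) j

  dropZeros-partition : ∀ ps → Decreasing ps → Partition (dropZeros ps)
  dropZeros-partition []           δ = none
  dropZeros-partition (zero ∷ ps)  δ = dropZeros-partition ps (λ i → δ (suc i))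
  dropZeros-partition (suc p ∷ ps) δ =
    Partition-∷ (s≤s z≤n) (≤-trans (eq≤ (dropZeros-at ps δ′ 0)) (δ 0)) (dropZeros-partition ps δ′)
    where
    δ′ : Decreasing ps
    δ′ i = δ (suc i)

  dropZeros-sum : ∀ ps → sum (dropZeros ps) ≡ sum ps
  dropZeros-sum []           = refl
  dropZeros-sum (zero ∷ ps)  = dropZeros-sum ps
  dropZeros-sum (suc p ∷ ps) = cong (suc p +_) (dropZeros-sum ps)

  dropZeros-injective : ∀ ps qs → Decreasing ps → Decreasing qs → length ps ≡ length qs →
    dropZeros ps ≡ dropZeros qs → ps ≡ qs
  dropZeros-injective ps qs δ ε len h = at-injective ps qs len λ j →
    trans (sym (dropZeros-at ps δ j)) (trans (cong (λ l → at l j) h) (dropZeros-at qs ε j))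

  rimLen-positive : ∀ {p ps} → Partition (p ∷ ps) → 1 ≤ rimLen p ps
  rimLen-positive (one p≥1)  = p≥1
  rimLen-positive (cons _ _) = s≤s z≤n

  module _ {d : ℕ} where

    rimRest-length : ∀ k ps → length (rimRest d k ps) ≡ length ps
    rimRest-length k []       = refl
    rimRest-length k (p ∷ ps) = cong suc (rimRest-length _ ps)

    rim-sum : ∀ k ps → Partition ps → sum (rimRest d k ps) + rimSize d k ps ≡ sum ps
    rim-sum k []       π = refl
    rim-sum k (p ∷ ps) π = total (k ⊓ rimLen p ps) _ _ _ _ _
      (m∸n+n≡m (≤-trans (m⊓n≤n k _) (rimLen≤ π))) (rim-sum _ ps (Partition-tail π))
      where
      total : ∀ m r s t p q → r + m ≡ p → s + t ≡ q → r + s + (m + t) ≡ p + q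
      total m r s t p q P Q = lineq (P ⊞ Q) (solve (m ∷ r ∷ s ∷ t ∷ p ∷ q ∷ []))

    rimSize-positive : ∀ {k p ps} → 1 ≤ k → Partition (p ∷ ps) → 1 ≤ rimSize d k (p ∷ ps)
    rimSize-positive k≥1 π = ≤-trans (⊓-glb k≥1 (rimLen-positive π)) (m≤m+n _ _)

    -- A row keeps all boxes above the next row except possibly one, and the next row loses at least
    -- one box because the room on entering it is positive.
    rimRest-decreasing : ∀ k ps → 1 ≤ k → k ≤ d → Partition ps → Decreasing (rimRest d k ps)
    rimRest-decreasing k [] k≥1 k≤d π j = z≤n
    rimRest-decreasing k (p ∷ []) k≥1 k≤d π j = z≤n
    rimRest-decreasing k (p ∷ q ∷ ps) k≥1 k≤d (cons q≤p π) zero = begin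
      q ∸ (k₁ ⊓ rimLen q ps)     ≤⟨ ∸-monoʳ-≤ q (⊓-glb (proj₁ room) (rimLen-positive π)) ⟩
      q ∸ 1                      ≡⟨ cong (_∸ 1) (sym (m∸[m∸n]≡n q≤p)) ⟩
      p ∸ (p ∸ q) ∸ 1            ≡⟨ ∸-+-assoc p (p ∸ q) 1 ⟩
      p ∸ (p ∸ q + 1)            ≡⟨ cong (p ∸_) (+-comm (p ∸ q) 1) ⟩
      p ∸ suc (p ∸ q)            ≤⟨ ∸-monoʳ-≤ p (m⊓n≤n k _) ⟩
      p ∸ (k ⊓ suc (p ∸ q))      ∎
      where
      open ≤-Reasoning
      k₁ = nextRoom d k (k ⊓ suc (p ∸ q))
      room = RowStep-room k≥1 k≤d (rowStep d k (suc (p ∸ q)))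
    rimRest-decreasing k (p ∷ q ∷ ps) k≥1 k≤d (cons q≤p π) (suc j) =
      rimRest-decreasing _ (q ∷ ps) (proj₁ room) (proj₂ room) π j
      where room = RowStep-room k≥1 k≤d (rowStep d k (suc (p ∸ q)))

  strip : ℕ → List ℕ → List ℕ
  strip d ps = dropZeros (rimRest d d ps)

  strip-partition : ∀ {d ps} → 1 ≤ d → Partition ps → Partition (strip d ps)
  strip-partition {d} {ps} d≥1 π = dropZeros-partition (rimRest d d ps) (rimRest-decreasing d ps d≥1 ≤-refl π)

  strip-sum : ∀ {d ps} → Partition ps → sum (strip d ps) + rimSize d d ps ≡ sum ps
  strip-sum {d} {ps} π = trans (cong (_+ rimSize d d ps) (dropZeros-sum (rimRest d d ps))) (rim-sum d ps π)

  strip-sum< : ∀ {d p ps} → 1 ≤ d → Partition (p ∷ ps) → sum (strip d (p ∷ ps)) < sum (p ∷ ps)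
  strip-sum< {d} {p} {ps} d≥1 π = <-≤-trans (m<m+n _ (rimSize-positive {d} d≥1 π)) (eq≤ (strip-sum {d} {p ∷ ps} π))

  strip-injective : ∀ {d ps qs} → 1 ≤ d → Partition ps → Partition qs → length ps ≡ length qs →
    rimSize d d ps ≡ rimSize d d qs → strip d ps ≡ strip d qs → ps ≡ qs
  strip-injective {d} {ps} {qs} d≥1 π ρ len size h = same ps qs (rim-injective d d ps qs d≥1 ≤-refl d≥1 ≤-refl π ρ len
      (dropZeros-injective _ _ (rimRest-decreasing d ps d≥1 ≤-refl π) (rimRest-decreasing d qs d≥1 ≤-refl ρ)
        (trans (rimRest-length d ps) (trans len (sym (rimRest-length d qs)))) h)
      0 0 (cong (λ t → t + d + d * 0) size))
    where
    same : ∀ ps qs → SameShift d d ps qs → ps ≡ qs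
    same []       []       _       = refl
    same (p ∷ ps) (q ∷ qs) (e , s) = cong₂ _∷_ (+-cancelʳ-≡ d p q s) e

  -- The fuel is only bounded below by the sums, because a removal may lower the sum by more than
  -- the one unit of fuel that it costs.
  symbol-injective : ∀ {d} f ps qs → 1 ≤ d → Partition ps → Partition qs → sum ps ≤ f → sum qs ≤ f →
    mullineuxSymbolGo d f ps ≡ mullineuxSymbolGo d f qs → ps ≡ qs
  symbol-injective zero [] [] _ _ _ _ _ _ = refl
  symbol-injective zero (p ∷ ps) qs _ π _ h _ _ = ⊥-elim (<⇒≱ (Partition-head π) (≤-trans (m≤m+n p (sum ps)) h))
  symbol-injective zero [] (q ∷ qs) _ _ ρ _ h _ = ⊥-elim (<⇒≱ (Partition-head ρ) (≤-trans (m≤m+n q (sum qs)) h))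
  symbol-injective (suc f) [] [] _ _ _ _ _ _ = refl
  symbol-injective (suc f) (p ∷ ps) (q ∷ qs) d≥1 π ρ hp hq e with ∷-injective e
  ... | e₁ , e₂ = strip-injective d≥1 π ρ (cong proj₂ e₁) (cong proj₁ e₁)
    (symbol-injective f _ _ d≥1 (strip-partition d≥1 π) (strip-partition d≥1 ρ)
      (s≤s⁻¹ (≤-trans (strip-sum< d≥1 π) hp)) (s≤s⁻¹ (≤-trans (strip-sum< d≥1 ρ) hq)) e₂)

  -- Traversing the rim

  -- The bound `at ps (suc j) ≤ i` exempts the leftmost rim box of a row that has a row below it: a
  -- segment ending there skips nothing, as the next one starts directly underneath.
  NoStop : ℕ → ℕ → List ℕ → Set
  NoStop d c ps = ∀ i j → i < at ps j → at ps (suc j) ≤ i → ∀ α → i + d * α ≡ c + j → ⊥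

  ∸-suc-∸ : ∀ {p q} → q ≤ p → p ∸ suc (p ∸ q) ≡ q ∸ 1
  ∸-suc-∸ {p} {q} q≤p = trans (cong (p ∸_) (+-comm 1 (p ∸ q)))
    (trans (sym (∸-+-assoc p (p ∸ q) 1)) (cong (_∸ 1) (m∸[m∸n]≡n q≤p)))

  -- A segment closing early would end at box `p ∸ k`, which has the forbidden residue. Closing
  -- exactly at the end of the row opens a new segment, whence `suc α`.
  fullRow : ∀ {d k m k₁} c α p q → q ≤ p → p + d * α ≡ c + k →
    (∀ i → i < p → q ≤ i → ∀ α → i + d * α ≡ c + 0 → ⊥) → 1 ≤ k →
    RowStep d k (suc (p ∸ q)) m k₁ → m ≡ suc (p ∸ q) × ∃[ β ] q + d * β ≡ suc c + k₁
  fullRow {d} {k} c α p q q≤p h ns k≥1 (closes k≤) with m≤n⇒m<n∨m≡n k≤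
  ... | inj₁ (s≤s k≤u) = ⊥-elim (ns (p ∸ k) (∸-monoʳ-< {o = 0} k≥1 k≤p) (≤-trans (eq≥ (m∸[m∸n]≡n q≤p)) (∸-monoʳ-≤ p k≤u)) α
      (stop (p ∸ k) (m∸n+n≡m k≤p)))
    where
    k≤p : k ≤ p
    k≤p = ≤-trans k≤u (m∸n≤m p q)
    stop : ∀ i → i + k ≡ p → i + d * α ≡ c + 0
    stop i I = lineq (I ⊞ h) (solve (i ∷ k ∷ p ∷ d ∷ α ∷ c ∷ []))
  ... | inj₂ refl = refl , suc α , next (p ∸ q) (m+[n∸m]≡n q≤p) h
    where
    next : ∀ u → q + u ≡ p → p + d * α ≡ c + suc u → q + d * suc α ≡ suc c + d
    next u U H = lineq (U ⊞ H) (solve (q ∷ u ∷ p ∷ d ∷ α ∷ c ∷ []))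
  fullRow {d} {k} c α p q q≤p h ns k≥1 (stays {k₁} k≡ _) = refl , α , next (p ∸ q) (m+[n∸m]≡n q≤p) k≡
    where
    next : ∀ u → q + u ≡ p → k ≡ suc u + k₁ → q + d * α ≡ suc c + k₁
    next u U K = lineq (U ⊞ h ⊞ K) (solve (q ∷ u ∷ p ∷ d ∷ α ∷ c ∷ k ∷ k₁ ∷ []))

  -- The whole rim is removed: the rows are those of the diagram moved one step along the diagonal,
  -- and the rim has one box less than first row and length together.
  record Traversed (rs : List ℕ) (t p : ℕ) (ps : List ℕ) : Set where
    constructor traversed
    field
      rest : ∀ j → at rs j ≡ at ps j ∸ 1
      size : t + 1 ≡ p + length (p ∷ ps)

  -- The hypothesis on p says that the segments start at boxes whose content is congruent to c - 1 modulo d,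
  -- contents being counted from the first row of the suffix; NoStop says that no other rim box has this
  -- residue, so that every segment ends at the end of a row.
  traverse : ∀ {d k} c α p ps → 1 ≤ k → k ≤ d → Partition (p ∷ ps) → p + d * α ≡ c + k →
    NoStop d c (p ∷ ps) → Traversed (rimRest d k (p ∷ ps)) (rimSize d k (p ∷ ps)) p ps
  traverse {d} {k} c α p [] k≥1 k≤d π h ns = row (rowStep d k p)
    where
    stop : ∀ i → i + k ≡ p → i + d * α ≡ c + 0
    stop i I = lineq (I ⊞ h) (solve (i ∷ k ∷ p ∷ d ∷ α ∷ c ∷ []))
    row : ∀ {m k₁} → RowStep d k p m k₁ → Traversed (p ∸ m ∷ []) (m + 0) p []
    row (closes k≤p) = ⊥-elim (ns (p ∸ k) 0 (∸-monoʳ-< {o = 0} k≥1 k≤p) z≤n α (stop (p ∸ k) (m∸n+n≡m k≤p)))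
    row (stays _ _) = traversed (λ { zero → n∸n≡0 p ; (suc j) → refl }) (cong (_+ 1) (+-identityʳ p))
  traverse {d} {k} c α p (q ∷ ps) k≥1 k≤d (cons q≤p π) h ns = row (rowStep d k (suc (p ∸ q)))
    where
    size : ∀ u t l → q + u ≡ p → t + 1 ≡ q + suc l → suc u + t + 1 ≡ p + suc (suc l)
    size u t l U T = lineq (U ⊞ T) (solve (u ∷ t ∷ l ∷ p ∷ q ∷ []))
    row : ∀ {m k₁} → RowStep d k (suc (p ∸ q)) m k₁ →
      Traversed (p ∸ m ∷ rimRest d k₁ (q ∷ ps)) (m + rimSize d k₁ (q ∷ ps)) p (q ∷ ps)
    row {m} {k₁} s with fullRow c α p q q≤p h (λ i → ns i 0) k≥1 s | RowStep-room k≥1 k≤d s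
    ... | refl , β , h₁ | k₁≥1 , k₁≤d = traversed
      (λ { zero → ∸-suc-∸ q≤p ; (suc j) → Traversed.rest rec j })
      (size (p ∸ q) _ _ (m+[n∸m]≡n q≤p) (Traversed.size rec))
      where
      rec : Traversed (rimRest d k₁ (q ∷ ps)) (rimSize d k₁ (q ∷ ps)) q ps
      rec = traverse (suc c) β q ps k₁≥1 k₁≤d π h₁ (λ i j i< ≤i γ e → ns i (suc j) i< ≤i γ (trans e (sym (+-suc c j))))

  -- Here `i` is the length of row `n + 1`: row `n` keeps `i` boxes instead of `i ∸ 1`, as one rim
  -- box stays. For `i = 0` there is no box to skip, hence `size₀`.
  record Skipped (rs : List ℕ) (t n i p : ℕ) (ps : List ℕ) : Set where
    constructor skipped
    field
      rest  : ∀ j → j ≢ n → at rs j ≡ at ps j ∸ 1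
      rest₀ : at rs n ≡ i
      size  : 1 ≤ i → t + 2 ≡ p + length (p ∷ ps)
      size₀ : i ≡ 0 → t + 1 ≡ p + length (p ∷ ps)

  -- In row n the segment ends exactly above row n + 1, so that the next segment skips one rim box.
  skip : ∀ {d} n k c α β i p ps → 1 ≤ k → k ≤ d → Partition (p ∷ ps) → p + d * α ≡ c + k →
    (∀ i j → j < n → i < at (p ∷ ps) j → at ps j ≤ i → ∀ α → i + d * α ≡ c + j → ⊥) →
    at ps n ≡ i → i + d * β ≡ c + n → i < at (p ∷ ps) n → at (p ∷ ps) n ≤ i + d →
    (∀ i′ j → i′ < at ps (n + j) → at ps (suc (n + j)) ≤ i′ → ∀ α → i′ + d * α ≡ i + j → ⊥) →
    Skipped (rimRest d k (p ∷ ps)) (rimSize d k (p ∷ ps)) n i p ps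
  skip {d} zero k c α β i p ps k≥1 k≤d π h _ at≡ hi i<p p≤i+d ns = first ps π at≡ ns
    where
    -- Both numbers lie between 1 and `d` and are congruent, so the room is used up by exactly those
    -- boxes of the row that have no box below them.
    k≡ : k ≡ p ∸ i
    k≡ = uniqueRep {x = β} {y = α} k≥1 k≤d (m<n⇒0<n∸m i<p) (m≤n+o⇒m∸n≤o p i p≤i+d) (rep (p ∸ i) (m∸n+n≡m (<⇒≤ i<p)))
      where
      rep : ∀ x → x + i ≡ p → k + d * β ≡ x + d * α
      rep x X = lineq (sym X ⊞ sym h ⊞ hi) (solve (x ∷ i ∷ p ∷ k ∷ d ∷ α ∷ β ∷ c ∷ []))
    first : ∀ ps → Partition (p ∷ ps) → at ps 0 ≡ i →
      (∀ i′ j → i′ < at ps j → at ps (suc j) ≤ i′ → ∀ α → i′ + d * α ≡ i + j → ⊥) →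
      Skipped (rimRest d k (p ∷ ps)) (rimSize d k (p ∷ ps)) 0 i p ps
    first [] _ refl _ = row (rowStep d k p)
      where
      row : ∀ {m k₁} → RowStep d k p m k₁ → Skipped (p ∸ m ∷ []) (m + 0) 0 0 p []
      row (closes _) = skipped
        (λ { zero j≢0 → ⊥-elim (j≢0 refl) ; (suc j) _ → refl }) (trans (cong (p ∸_) k≡) (n∸n≡0 p)) (λ ())
        (λ _ → cong (_+ 1) (trans (+-identityʳ k) k≡))
      row (stays {k₁} k≡p+k₁ k₁≥1) =
        ⊥-elim (<-irrefl k≡p+k₁ (<-≤-trans (s≤s (eq≤ k≡)) (≤-trans (eq≤ (+-comm 1 p)) (+-monoʳ-≤ p k₁≥1))))
    first (q ∷ ps) (cons q≤p π) refl ns = row (rowStep d k (suc (p ∸ q)))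
      where
      rec : Traversed (rimRest d d (q ∷ ps)) (rimSize d d (q ∷ ps)) q ps
      rec = traverse q 1 q ps (≤-trans k≥1 k≤d) ≤-refl π (cong (q +_) (*-identityʳ d)) ns
      size : ∀ t l → q + k ≡ p → t + 1 ≡ q + suc l → k + t + 2 ≡ p + suc (suc l)
      size t l U T = lineq (U ⊞ T) (solve (t ∷ l ∷ k ∷ p ∷ q ∷ []))
      row : ∀ {m k₁} → RowStep d k (suc (p ∸ q)) m k₁ →
        Skipped (p ∸ m ∷ rimRest d k₁ (q ∷ ps)) (m + rimSize d k₁ (q ∷ ps)) 0 q p (q ∷ ps)
      row (closes _) = skipped
        (λ { zero j≢0 → ⊥-elim (j≢0 refl) ; (suc j) _ → Traversed.rest rec j })
        (trans (cong (p ∸_) k≡) (m∸[m∸n]≡n q≤p))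
        (λ _ → size _ _ (trans (cong (q +_) k≡) (m+[n∸m]≡n q≤p)) (Traversed.size rec))
        (λ q≡0 → ⊥-elim (<-irrefl (sym q≡0) (Partition-head π)))
      row (stays {k₁} k≡′ k₁≥1) =
        ⊥-elim (<-irrefl (sym k≡) (≤-trans (s≤s (m≤m+n (p ∸ q) k₁)) (eq≥ k≡′)))
  skip {d} (suc n) k c α β i p [] k≥1 k≤d π h ns at≡ hi () at≤ ns₂
  skip {d} (suc n) k c α β i p (q ∷ ps) k≥1 k≤d (cons q≤p π) h ns at≡ hi i<at at≤ ns₂ = row (rowStep d k (suc (p ∸ q)))
    where
    size : ∀ u t l → q + u ≡ p → t + 2 ≡ q + suc l → suc u + t + 2 ≡ p + suc (suc l)
    size u t l U T = lineq (U ⊞ T) (solve (u ∷ t ∷ l ∷ p ∷ q ∷ []))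
    size₀ : ∀ u t l → q + u ≡ p → t + 1 ≡ q + suc l → suc u + t + 1 ≡ p + suc (suc l)
    size₀ u t l U T = lineq (U ⊞ T) (solve (u ∷ t ∷ l ∷ p ∷ q ∷ []))
    row : ∀ {m k₁} → RowStep d k (suc (p ∸ q)) m k₁ →
      Skipped (p ∸ m ∷ rimRest d k₁ (q ∷ ps)) (m + rimSize d k₁ (q ∷ ps)) (suc n) i p (q ∷ ps)
    row {m} {k₁} s with fullRow c α p q q≤p h (λ i → ns i 0 (s≤s z≤n)) k≥1 s | RowStep-room k≥1 k≤d s
    ... | refl , γ , h₁ | k₁≥1 , k₁≤d = skipped
      (λ { zero _ → ∸-suc-∸ q≤p ; (suc j) j≢n → Skipped.rest rec j (λ j≡n → j≢n (cong suc j≡n)) })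
      (Skipped.rest₀ rec)
      (λ i≥1 → size (p ∸ q) _ _ (m+[n∸m]≡n q≤p) (Skipped.size rec i≥1))
      (λ i≡0 → size₀ (p ∸ q) _ _ (m+[n∸m]≡n q≤p) (Skipped.size₀ rec i≡0))
      where
      rec : Skipped (rimRest d k₁ (q ∷ ps)) (rimSize d k₁ (q ∷ ps)) n i q ps
      rec = skip n k₁ (suc c) γ β i q ps k₁≥1 k₁≤d π h₁
        (λ i j j<n i< ≤i γ e → ns i (suc j) (s≤s j<n) i< ≤i γ (trans e (sym (+-suc c j))))
        at≡ (trans hi (+-suc c n)) i<at at≤ ns₂

  -- Diagrams below a line

  -- The box in column i and row j, both counted from 0, has value e i + f j; boxes on the line
  -- e i + f j = M are taken only from the rows above row J.
  Below : (e f M J i j : ℕ) → Set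
  Below e f M J i j = e * i + f * j < M ⊎ (e * i + f * j ≡ M × j < J)

  record Shape (e f M J : ℕ) (lam : List ℕ) : Set where
    constructor shape
    field
      partition : Partition lam
      inside    : ∀ i j → i < at lam j → Below e f M J i j
      covers    : ∀ i j → Below e f M J i j → i < at lam j

  module _ {e f M J lam} (S : Shape e f M J lam) where
    open Shape S

    inside-≤ : ∀ i j → i < at lam j → e * i + f * j ≤ M
    inside-≤ i j i< with inside i j i<
    ... | inj₁ v<M       = <⇒≤ v<M
    ... | inj₂ (v≡M , _) = eq≤ v≡M

    inside-< : ∀ i j → i < at lam j → J ≤ j → e * i + f * j < M
    inside-< i j i< J≤j with inside i j i<
    ... | inj₁ v<M       = v<M
    ... | inj₂ (_ , j<J) = ⊥-elim (<⇒≱ j<J J≤j)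

    outside-≥ : ∀ i j → at lam j ≤ i → M ≤ e * i + f * j
    outside-≥ i j ≤i = ≮⇒≥ λ v<M → <⇒≱ (covers i j (inj₁ v<M)) ≤i

    outside-> : ∀ i j → at lam j ≤ i → j < J → M < e * i + f * j
    outside-> i j ≤i j<J = ≤∧≢⇒< (outside-≥ i j ≤i) λ M≡v → <⇒≱ (covers i j (inj₂ (sym M≡v , j<J))) ≤i

  -- `C` is `M / e` rounded up, given by a property so that a first row or a length can be
  -- recognised as this number without division.
  IsCount : ℕ → ℕ → ℕ → Set
  IsCount e M C = (∀ i → i < C → e * i < M) × (∀ i → e * i < M → i < C)

  <-extensional : ∀ {m n} → (∀ i → i < m → i < n) → (∀ i → i < n → i < m) → m ≡ n
  <-extensional {m} {n} f g = ≤-antisym (≮⇒≥ λ n<m → <-irrefl refl (f n n<m)) (≮⇒≥ λ m<n → <-irrefl refl (g m m<n))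

  IsCount-unique : ∀ {e M C C′} → IsCount e M C → IsCount e M C′ → C ≡ C′
  IsCount-unique (f , g) (f′ , g′) = <-extensional (λ i i< → g′ i (f i i<)) (λ i i< → g i (f′ i i<))

  scale-< : ∀ {e i j} → 1 ≤ e → i < j → e * i < e * j
  scale-< {e} e≥1 = *-monoʳ-< e {{>-nonZero e≥1}}

  IsCount-multiple : ∀ {e M D} → 1 ≤ e → M ≡ e * D → IsCount e M D
  IsCount-multiple {e} e≥1 refl = (λ i i<D → scale-< e≥1 i<D) , (λ i → *-cancelˡ-< e _ _)

  <∸1⇒ : ∀ {i n} → i < n ∸ 1 → suc i < n
  <∸1⇒ {i} {suc n} i<n = s≤s i<n

  ⇒<∸1 : ∀ {i n} → suc i < n → i < n ∸ 1
  ⇒<∸1 {i} {suc n} (s≤s i<n) = i<n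

  Below-mono : ∀ {e f M J J′ i j} → J ≤ J′ → Below e f M J i j → Below e f M J′ i j
  Below-mono J≤J′ (inj₁ v<M)         = inj₁ v<M
  Below-mono J≤J′ (inj₂ (v≡M , j<J)) = inj₂ (v≡M , <-≤-trans j<J J≤J′)

  -- The condition is put on the box one step further along the diagonal and `M` is kept, because
  -- `M ∸ (e + f)` would be truncated for small `M`.
  record StripShape (e f M J : ℕ) (rs : List ℕ) : Set where
    constructor stripShape
    field
      inside : ∀ i j → i < at rs j → Below e f M J (suc i) (suc j)
      covers : ∀ i j → Below e f M J (suc i) (suc j) → i < at rs j

  -- Otherwise `e` would divide `f * j`, hence `j`. This keeps boxes of one line in different rows
  -- at least `e` rows apart.
  e∤ : ∀ {e f j} → Coprime e f → 1 ≤ j → j < e → ∀ x y → e * x ≡ e * y + f * j → ⊥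
  e∤ {e} {f} {j} e⊥f j≥1 j<e x y h =
    >⇒∤ {{>-nonZero j≥1}} j<e (coprime-divisor e⊥f (∣m+n∣m⇒∣n (subst (e ∣_) h (m∣m*n x)) (m∣m*n y)))

  -- As `f` is congruent to `-e` modulo `e + f`, multiplying a content by `e` gives the value of the
  -- box; forbidden residues can then be excluded by estimating values.
  stopValue : ∀ {e f i α c j} → i + (e + f) * α ≡ c + j → e * i + f * j + (e + f) * (e * α) ≡ e * c + (e + f) * j
  stopValue {e} {f} {i} {α} {c} {j} h = lineq (e ⊠ h) (solve (e ∷ f ∷ i ∷ α ∷ c ∷ j ∷ []))

  module _ {e f : ℕ} (e≥1 : 1 ≤ e) where

    -- No rim box is skipped when the last line has no box in row 0.
    strip-plain : ∀ {M J p ps} → (∀ x → e * x ≡ M → J ≡ 0) → Shape e f M J (p ∷ ps) →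
      StripShape e f M J (rimRest (e + f) (e + f) (p ∷ ps)) × rimSize (e + f) (e + f) (p ∷ ps) + 1 ≡ p + length (p ∷ ps)
    strip-plain {M} {J} {p} {ps} nx S = stripShape
        (λ i j i< → inside (suc i) (suc j) (<∸1⇒ (≤-trans i< (eq≤ (Traversed.rest tr j)))))
        (λ i j b → ≤-trans (⇒<∸1 (covers (suc i) (suc j) b)) (eq≥ (Traversed.rest tr j))) ,
      Traversed.size tr
      where
      open Shape S
      d = e + f
      above : e * p + f * 0 < M + e
      above = last p (Partition-head partition) (λ i → inside i 0)
        where
        last : ∀ p → 1 ≤ p → (∀ i → i < p → Below e f M J i 0) → e * p + f * 0 < M + e
        last (suc i) _ ins with ins i ≤-refl
        ... | inj₁ v<M = cert 0 v<M (solve (e ∷ f ∷ i ∷ M ∷ []))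
        ... | inj₂ (v≡M , 0<J) = ⊥-elim (>⇒≢ 0<J (nx i (lineq v≡M (solve (e ∷ f ∷ i ∷ M ∷ [])))))
      gap : ∀ i j → i < at (p ∷ ps) j → e * i + f * j < e * p + f * 0
      gap i j i< with m≤n⇒m<n∨m≡n (outside-≥ S p 0 ≤-refl)
      ... | inj₁ M<w = ≤-<-trans (inside-≤ S i j i<) M<w
      ... | inj₂ M≡w = <-≤-trans (inside-< S i j i< (≤-trans (eq≤ (nx p (lineq (sym M≡w) (solve (e ∷ f ∷ p ∷ M ∷ []))))) z≤n)) (eq≤ M≡w)
      -- The value of a stop would be congruent to `e * p`, but a box of the diagram with nothing
      -- below it has a value strictly between `e * p - d` and `e * p`.
      noStop : NoStop d p (p ∷ ps)
      noStop i j i< ≤i α h = noCong (e + f) (e * α) j (stopValue {e} {f} h)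
        (≤-trans (gap i j i<) (eq≤ (solve (e ∷ f ∷ p ∷ []))))
        (cert 0 (above ⊕ outside-≥ S i (suc j) ≤i) (solve (e ∷ f ∷ i ∷ j ∷ p ∷ M ∷ [])))
      tr = traverse p 1 p ps (≤-trans e≥1 (m≤m+n e f)) ≤-refl partition (cong (p +_) (*-identityʳ d)) noStop

    record SkipShape (M J i : ℕ) (p : ℕ) (ps : List ℕ) : Set where
      constructor skipShape
      field
        strips : StripShape e f M J (rimRest (e + f) (e + f) (p ∷ ps))
        size   : 1 ≤ i → rimSize (e + f) (e + f) (p ∷ ps) + 2 ≡ p + length (p ∷ ps)
        size₀  : i ≡ 0 → rimSize (e + f) (e + f) (p ∷ ps) + 1 ≡ p + length (p ∷ ps)

    topRow : ∀ {M J D lam} → 1 ≤ J → M ≡ e * D → Shape e f M J lam → at lam 0 ≡ suc D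
    topRow {M} {J} {D} {lam} J≥1 M≡ S = <-extensional
      (λ i i< → s≤s (*-cancelˡ-≤ e {{>-nonZero e≥1}} (≤-trans (≤-trans (m≤m+n (e * i) (f * 0)) (inside-≤ S i 0 i<)) (eq≤ M≡))))
      (λ i i≤D → Shape.covers S i 0 (value i (m≤n⇒m<n∨m≡n (≤-trans (*-monoʳ-≤ e (s≤s⁻¹ i≤D)) (eq≥ M≡)))))
      where
      value : ∀ i → e * i < M ⊎ e * i ≡ M → Below e f M J i 0
      value i (inj₁ v<M) = inj₁ (cert 0 v<M (solve (e ∷ f ∷ i ∷ M ∷ [])))
      value i (inj₂ v≡M) = inj₂ (lineq v≡M (solve (e ∷ f ∷ i ∷ M ∷ [])) , J≥1)

    -- The last line has a box in row 0: the rim skips one box beside the first box (i , n + 1) of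
    -- that line outside the diagram, unless i = 0.
    strip-skip : ∀ {M n i D t p ps} → 1 ≤ f → Coprime e f → M ≡ e * i + f * suc n → M ≡ e * D →
      i + (e + f) * t ≡ suc D + n → Shape e f M (suc n) (p ∷ ps) → SkipShape M (e + suc n) i p ps
    strip-skip {M} {n} {i} {D} {t} {p} {ps} f≥1 e⊥f M≡ M≡eD it≡ S =
      -- If `i` is positive, the skipped rim box is moved onto the box of the line in row `n + 1`,
      -- making up for the one lost in row 0. The next box of the line is `e` rows lower, whence the
      -- bound `e + suc n`.
      skipShape (stripShape strip-inside strip-covers) (Skipped.size sk) (Skipped.size₀ sk)
      where
      open Shape S
      lam = p ∷ ps
      corner : at ps n ≡ i
      corner = <-extensional
        (λ x x< → *-cancelˡ-< e x i (cert 0 (inside-< S x (suc n) x< ≤-refl ⊕ eq≤ M≡) (solve (e ∷ f ∷ n ∷ x ∷ i ∷ M ∷ []))))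
        (λ x x<i → covers x (suc n) (inj₁ (cert 0 (scale-< e≥1 x<i ⊕ eq≥ M≡) (solve (e ∷ f ∷ n ∷ x ∷ i ∷ M ∷ [])))))
      i<at : i < at lam n
      i<at = covers i n (inj₁ (cert 0 (f≥1 ⊕ eq≥ M≡) (solve (e ∷ f ∷ n ∷ i ∷ M ∷ []))))
      at≤ : at lam n ≤ i + (e + f)
      at≤ = ≮⇒≥ λ lt → far (inside-≤ S (i + (e + f)) n lt)
        where
        far : e * (i + (e + f)) + f * n ≤ M → ⊥
        ee≥1 : 1 ≤ e * e
        ee≥1 = *-mono-≤ e≥1 e≥1
        far le = absurd 0 (le ⊕ eq≤ M≡ ⊕ f ⊛ e≥1 ⊕ ee≥1) (solve (e ∷ f ∷ n ∷ i ∷ M ∷ []))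
      stop₁ : ∀ x j → j < n → x < at lam j → at ps j ≤ x → ∀ α → x + (e + f) * α ≡ p + j → ⊥
      stop₁ x j j<n x< ≤x α h = noCong (e + f) (e * α) j (stopValue {e} {f} h)
        (≤-<-trans (inside-≤ S x j x<) M<w)
        (w< (outside-> S x (suc j) ≤x (s≤s j<n)))
        where
        w≡ : e * p ≡ M + e
        w≡ = trans (cong (e *_) (topRow {J = suc n} (s≤s z≤n) M≡eD S)) (lineq (sym M≡eD) (solve (e ∷ D ∷ M ∷ [])))
        M<w : M < e * p
        M<w = cert 0 (e≥1 ⊕ eq≥ w≡) (solve (e ∷ p ∷ M ∷ []))
        w< : M < e * x + f * suc j → e * p < e * x + f * j + (e + f)
        w< lt = cert 0 (lt ⊕ eq≤ w≡) (solve (e ∷ f ∷ p ∷ M ∷ x ∷ j ∷ []))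
      -- In the rows above, the forbidden values are those congruent to `e * p = M + e`. From row
      -- `n + 1` on they are those congruent to `M`, and no box of the diagram there reaches the
      -- line.
      stop₂ : ∀ x j → x < at ps (n + j) → at ps (suc (n + j)) ≤ x → ∀ α → x + (e + f) * α ≡ i + j → ⊥
      stop₂ x j x< ≤x α h = noCong (e + f) (e * α) j value
        (inside-< S x (suc (n + j)) x< (s≤s (m≤m+n n j)))
        (w< (outside-≥ S x (suc (suc (n + j))) ≤x))
        where
        value : e * x + f * suc (n + j) + (e + f) * (e * α) ≡ M + (e + f) * j
        value = lineq (e ⊠ h ⊞ sym M≡) (solve (e ∷ f ∷ x ∷ n ∷ j ∷ α ∷ M ∷ i ∷ []))
        w< : M ≤ e * x + f * suc (suc (n + j)) → M < e * x + f * suc (n + j) + (e + f)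
        w< le = cert 0 (le ⊕ e≥1) (solve (e ∷ f ∷ x ∷ n ∷ j ∷ M ∷ []))
      sk : Skipped (rimRest (e + f) (e + f) lam) (rimSize (e + f) (e + f) lam) n i p ps
      sk = skip n (e + f) p 1 t i p ps (≤-trans e≥1 (m≤m+n e f)) ≤-refl partition (cong (p +_) (*-identityʳ (e + f)))
        stop₁ corner (trans it≡ (cong (_+ n) (sym (topRow {J = suc n} (s≤s z≤n) M≡eD S)))) i<at at≤ stop₂
      strip-inside : ∀ x j → x < at (rimRest (e + f) (e + f) lam) j → Below e f M (e + suc n) (suc x) (suc j)
      strip-inside x j x< with j ≟ n
      ... | no j≢n = Below-mono {e} {f} (m≤n+m (suc n) e) (inside (suc x) (suc j) (<∸1⇒ (≤-trans x< (eq≤ (Skipped.rest sk j j≢n)))))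
      ... | yes refl = value (m≤n⇒m<n∨m≡n (le (≤-trans x< (eq≤ (Skipped.rest₀ sk)))))
        where
        le : x < i → e * suc x + f * suc n ≤ M
        le x<i = cert 0 (e ⊛ x<i ⊕ eq≥ M≡) (solve (e ∷ f ∷ x ∷ n ∷ i ∷ M ∷ []))
        value : e * suc x + f * suc n < M ⊎ e * suc x + f * suc n ≡ M → Below e f M (e + suc n) (suc x) (suc n)
        value (inj₁ v<M) = inj₁ v<M
        value (inj₂ v≡M) = inj₂ (v≡M , m<n+m (suc n) e≥1)
      strip-covers : ∀ x j → Below e f M (e + suc n) (suc x) (suc j) → x < at (rimRest (e + f) (e + f) lam) j
      strip-covers x j b with j ≟ n
      ... | no j≢n = ≤-trans (⇒<∸1 (covers (suc x) (suc j) (narrow b))) (eq≥ (Skipped.rest sk j j≢n))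
        where
        narrow : Below e f M (e + suc n) (suc x) (suc j) → Below e f M (suc n) (suc x) (suc j)
        narrow (inj₁ v<M) = inj₁ v<M
        narrow (inj₂ (v≡M , j<)) with <-cmp j n
        ... | tri< j<n _ _ = inj₂ (v≡M , s≤s j<n)
        ... | tri≈ _ j≡n _ = ⊥-elim (j≢n j≡n)
        ... | tri> _ _ n<j = ⊥-elim (gap (j ∸ n) (m+[n∸m]≡n (<⇒≤ n<j)) (m<n⇒0<n∸m n<j))
          where
          gap : ∀ y → n + y ≡ j → 1 ≤ y → ⊥
          gap y Y y≥1 = e∤ e⊥f y≥1 (cert 0 (j< ⊕ eq≤ Y) (solve (y ∷ e ∷ n ∷ j ∷ []))) i (suc x)
            (lineq (sym v≡M ⊞ sym M≡ ⊞ f ⊠ sym Y) (solve (e ∷ f ∷ x ∷ n ∷ i ∷ M ∷ y ∷ j ∷ [])))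
      ... | yes refl = ≤-trans (le (below b)) (eq≥ (Skipped.rest₀ sk))
        where
        below : Below e f M (e + suc n) (suc x) (suc n) → e * suc x + f * suc n ≤ M
        below (inj₁ v<M)       = <⇒≤ v<M
        below (inj₂ (v≡M , _)) = eq≤ v≡M
        le : e * suc x + f * suc n ≤ M → x < i
        le h = *-cancelˡ-≤ e {{>-nonZero e≥1}} (cert 0 (h ⊕ eq≤ M≡) (solve (e ∷ f ∷ x ∷ n ∷ i ∷ M ∷ [])))

  -- Removing the rim from two diagrams below a line

  -- With `prev` this is subtraction of 1 from the digits `i₀ < f` and `j₀ < e` of `M`, as happens
  -- when `M` is lowered by `e + f`: a digit 0 wraps around and takes 1 from `K`.
  borrow : ℕ → ℕ
  borrow zero    = 1
  borrow (suc _) = 0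

  prev : ℕ → ℕ → ℕ
  prev e zero    = e ∸ 1
  prev e (suc j) = j

  prev-suc : ∀ {e} j → 1 ≤ e → j + e * borrow j ≡ suc (prev e j)
  prev-suc {suc e} zero    _ = cong suc (*-identityʳ e)
  prev-suc {e}     (suc j) _ = cong suc (trans (cong (j +_) (*-zeroʳ e)) (+-identityʳ j))

  prev-< : ∀ {e j} → j < e → prev e j < e
  prev-< {suc e} {zero}  _   = ≤-refl
  prev-< {e}     {suc j} j<e = <-trans (n<1+n j) j<e

  Last : ℕ → ℕ → ℕ → ℕ → Set
  Last i₀ j₀ K t = i₀ ≡ 0 × j₀ ≡ 0 × t ≡ K

  -- `C` is to be the length of the partner diagram. Then `size` and `size₀` are Mullineux's
  -- relation between the two lengths for a rim size not divisible by `d` and for one divisible by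
  -- `d`.
  record PartStrip (e f M J C d : ℕ) (last : Set) (lam : List ℕ) : Set where
    constructor partStrip
    field
      strips : StripShape e f M J (rimRest d d lam)
      rows   : IsCount f M (length lam)
      size   : ¬ last → rimSize d d lam + 1 ≡ C + length lam
      size₀  : last → rimSize d d lam ≡ C + length lam

  length-count : ∀ {e} f {M J lam} → (∀ j → f * j ≡ M → J ≤ j) → Shape e f M J lam → IsCount f M (length lam)
  length-count {e} f {M} {J} {lam} late S =
    (λ j j< → value j (Shape.inside S 0 j (at-length (Shape.partition S) j<))) ,
    (λ j v<M → length-at lam (Shape.covers S 0 j (inj₁ (cert 0 v<M (solve (e ∷ f ∷ j ∷ M ∷ []))))))
    where
    value : ∀ j → Below e f M J 0 j → f * j < M
    value j (inj₁ v<M) = cert 0 v<M (solve (e ∷ f ∷ j ∷ M ∷ []))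
    value j (inj₂ (v≡M , j<J)) = ⊥-elim (<⇒≱ j<J (late j (lineq v≡M (solve (e ∷ f ∷ j ∷ M ∷ [])))))

  head-count : ∀ e {f M J lam} → (∀ i → e * i ≡ M → J ≡ 0) → Shape e f M J lam → IsCount e M (at lam 0)
  head-count e {f} {M} {J} {lam} nx S =
    (λ i i< → value i (Shape.inside S i 0 i<)) ,
    (λ i v<M → Shape.covers S i 0 (inj₁ (cert 0 v<M (solve (e ∷ f ∷ i ∷ M ∷ [])))))
    where
    value : ∀ i → Below e f M J i 0 → e * i < M
    value i (inj₁ v<M) = cert 0 v<M (solve (e ∷ f ∷ i ∷ M ∷ []))
    value i (inj₂ (v≡M , 0<J)) = ⊥-elim (>⇒≢ 0<J (nx i (lineq v≡M (solve (e ∷ f ∷ i ∷ M ∷ [])))))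

  -- A box of the line in column 0 can only be its lowest one, in row `j₀ + e * K` or below. It is
  -- therefore outside the diagram, and the length counts exactly the rows with `f * j < M`.
  part-late : ∀ {e f M} i₀ {j₀ K t} → 1 ≤ f → M ≡ e * i₀ + f * j₀ + e * f * K → t ≤ K →
    ∀ j → f * j ≡ M → j₀ + e * t ≤ j
  part-late {e} {f} {M} i₀ {j₀} {K} {t} f≥1 M≡ t≤K j h = *-cancelˡ-≤ f {{>-nonZero f≥1}} le
    where
    le : f * (j₀ + e * t) ≤ f * j
    le = cert (e * i₀) (eq≥ h ⊕ eq≥ M≡ ⊕ (e * f) ⊛ t≤K) (solve (e ∷ f ∷ i₀ ∷ K ∷ M ∷ j ∷ j₀ ∷ t ∷ []))

  part-strip : ∀ {e f d M C i₀} j₀ {K t lam} → 1 ≤ e → 1 ≤ f → Coprime e f → d ≡ e + f → 1 ≤ length lam →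
    i₀ < f → j₀ < e → 1 ≤ t → t ≤ K → M ≡ e * i₀ + f * j₀ + e * f * K → IsCount e M C →
    Shape e f M (j₀ + e * t) lam → PartStrip e f M (suc (prev e j₀) + e * t) C d (Last i₀ j₀ K t) lam
  part-strip {e} {f} {_} {M} {C} {i₀} (suc j) {K} {t} {lam@(p ∷ ps)} e≥1 f≥1 e⊥f refl _ i₀<f j<e t≥1 t≤K M≡ isC S =
    partStrip (proj₁ r) (length-count f (part-late {e} {f} i₀ f≥1 M≡ t≤K) S)
      (λ _ → trans (proj₂ r) (cong (_+ length lam) (IsCount-unique {e} {M} (head-count e nx S) isC))) (λ ())
    where
    nx : ∀ x → e * x ≡ M → suc j + e * t ≡ 0
    nx x h = ⊥-elim (e∤ e⊥f (s≤s z≤n) j<e x (i₀ + f * K) (lineq (h ⊞ M≡) (solve (e ∷ x ∷ f ∷ i₀ ∷ K ∷ M ∷ j ∷ []))))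
    r = strip-plain e≥1 nx S
  part-strip {e} {f} {_} {M} {C} {i₀} zero {K} {t} {lam@(p ∷ ps)} e≥1 f≥1 e⊥f refl _ i₀<f j<e t≥1 t≤K M≡ isC S =
    -- The first box of the line outside the diagram is in row `suc n = e * t` and column
    -- `i₀ + f * s`, with `s = K - t` further boxes after it; `D` is the column of the box of the
    -- line in row 0.
    go (K ∸ t) (e * t ∸ 1) (m+[n∸m]≡n t≤K) (m+[n∸m]≡n (*-mono-≤ e≥1 t≥1))
    where
    go : ∀ s n → t + s ≡ K → suc n ≡ e * t → PartStrip e f M (suc (e ∸ 1) + e * t) C (e + f) (Last i₀ 0 K t) lam
    go s n K≡ n≡ = partStrip
        (subst (λ J → StripShape e f M J (rimRest (e + f) (e + f) lam)) (cong₂ _+_ (sym (m+[n∸m]≡n e≥1)) n≡) (SkipShape.strips r))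
        (length-count f (part-late {e} {f} i₀ f≥1 M≡ t≤K) S)
        (λ ¬last → size (SkipShape.size r (n≢0⇒n>0 λ i≡0 → ¬last (split i≡0))))
        (λ last → size₀ (SkipShape.size₀ r (join last)))
      where
      i = i₀ + f * s
      D = i₀ + f * K
      M≡eD : M ≡ e * (i₀ + f * K)
      M≡eD = lineq M≡ (solve (e ∷ f ∷ i₀ ∷ K ∷ M ∷ []))
      M≡ei : M ≡ e * (i₀ + f * s) + f * suc n
      M≡ei = lineq (M≡ ⊞ e * f ⊠ sym K≡ ⊞ f ⊠ sym n≡) (solve (e ∷ f ∷ i₀ ∷ K ∷ M ∷ n ∷ s ∷ t ∷ []))
      it≡ : i₀ + f * s + (e + f) * t ≡ suc (i₀ + f * K) + n
      it≡ = lineq (f ⊠ K≡ ⊞ sym n≡) (solve (e ∷ f ∷ i₀ ∷ K ∷ n ∷ s ∷ t ∷ []))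
      S′ : Shape e f M (suc n) lam
      S′ = subst (λ J → Shape e f M J lam) (sym n≡) S
      r : SkipShape e≥1 M (e + suc n) i p ps
      r = strip-skip e≥1 {D = D} {t = t} f≥1 e⊥f M≡ei M≡eD it≡ S′
      C≡ : C ≡ D
      C≡ = IsCount-unique {e} {M} isC (IsCount-multiple e≥1 M≡eD)
      p≡ : p ≡ suc D
      p≡ = topRow e≥1 (s≤s z≤n) M≡eD S′
      size : rimSize (e + f) (e + f) lam + 2 ≡ p + length lam → rimSize (e + f) (e + f) lam + 1 ≡ C + length lam
      size h = suc-injective (trans (sym (+-suc (rimSize (e + f) (e + f) lam) 1))
                 (trans h (cong₂ (λ p c → p + length lam) (trans p≡ (cong suc (sym C≡))) C≡)))
      size₀ : rimSize (e + f) (e + f) lam + 1 ≡ p + length lam → rimSize (e + f) (e + f) lam ≡ C + length lam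
      size₀ h = suc-injective (trans (+-comm 1 (rimSize (e + f) (e + f) lam))
                 (trans h (cong (_+ length lam) (trans p≡ (cong suc (sym C≡))))))
      split : i ≡ 0 → Last i₀ 0 K t
      split i≡0 = m+n≡0⇒m≡0 i₀ i≡0 , refl , trans (sym (+-identityʳ t)) (trans (cong (t +_) (sym (s≡0 (m*n≡0⇒m≡0∨n≡0 f (m+n≡0⇒n≡0 i₀ i≡0))))) K≡)
        where
        s≡0 : f ≡ 0 ⊎ s ≡ 0 → s ≡ 0
        s≡0 (inj₁ f≡0) = ⊥-elim (>⇒≢ f≥1 f≡0)
        s≡0 (inj₂ h)   = h
      join : Last i₀ 0 K t → i ≡ 0
      join (refl , _ , refl) = trans (cong (f *_) (m+n≡m⇒n≡0 t K≡)) (*-zeroʳ f)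
        where
        m+n≡m⇒n≡0 : ∀ m {n} → m + n ≡ m → n ≡ 0
        m+n≡m⇒n≡0 m h = +-cancelˡ-≡ m _ _ (trans h (sym (+-identityʳ m)))

  strip-shape : ∀ {e f M J M′ J′ d lam} → 1 ≤ d → Partition lam → StripShape e f M J (rimRest d d lam) →
    (∀ i j → Below e f M J (suc i) (suc j) → Below e f M′ J′ i j) →
    (∀ i j → Below e f M′ J′ i j → Below e f M J (suc i) (suc j)) → Shape e f M′ J′ (strip d lam)
  strip-shape {d = d} {lam} d≥1 π ss to from = shape (strip-partition d≥1 π)
    (λ i j i< → to i j (StripShape.inside ss i j (≤-trans i< (eq≤ (at≡ j)))))
    (λ i j b → ≤-trans (StripShape.covers ss i j (from i j b)) (eq≥ (at≡ j)))
    where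
    at≡ : ∀ j → at (strip d lam) j ≡ at (rimRest d d lam) j
    at≡ = dropZeros-at (rimRest d d lam) (rimRest-decreasing d lam d≥1 ≤-refl π)

  -- With `C` and `R` lowered by one as in the last clause, divisibility would make `e * suc C`
  -- congruent to `f * R`, whereas the two counts put their difference strictly between 0 and `d`.
  count-∤ : ∀ {e f M C R A d} → 1 ≤ e → 1 ≤ f → 1 ≤ M → IsCount e M C → IsCount f M R → d ≡ e + f →
    A + 1 ≡ C + R → d ∣ A → ⊥
  count-∤ {e} {f} {M} {C} {zero} e≥1 f≥1 M≥1 isC (_ , r) _ A≡ _ =
    n≮0 (r 0 (≤-trans (s≤s (eq≤ (*-zeroʳ f))) M≥1))
  count-∤ {e} {f} {M} {zero} e≥1 f≥1 M≥1 (_ , c) isR _ A≡ _ =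
    n≮0 (c 0 (≤-trans (s≤s (eq≤ (*-zeroʳ e))) M≥1))
  count-∤ {e} {f} {M} {suc C} {suc R} {A} e≥1 f≥1 M≥1 (c , c′) (r , r′) refl A≡ (divides q A≡qd) =
    noCong (e + f) (e * q) R congruent
      (<-≤-trans (r R ≤-refl) C-large) (small (c C ≤-refl) R-large)
    where
    C-large : M ≤ e * suc C
    C-large = ≮⇒≥ λ h → <-irrefl refl (c′ (suc C) h)
    R-large : M ≤ f * suc R
    R-large = ≮⇒≥ λ h → <-irrefl refl (r′ (suc R) h)
    small : e * C < M → M ≤ f * suc R → e * suc C < f * R + (e + f)
    small h k = cert 0 (h ⊕ k) (solve (e ∷ f ∷ C ∷ R ∷ M ∷ []))
    congruent : f * R + (e + f) * (e * q) ≡ e * suc C + (e + f) * R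
    congruent = lineq (e ⊠ sym A≡qd ⊞ e ⊠ A≡) (solve (e ∷ f ∷ C ∷ R ∷ A ∷ q ∷ []))

  -- In part, the last line e i + f j = M consists of the K + 1 boxes (i₀ + f s , j₀ + e (K - s));
  -- ps contains the t boxes of it in the highest rows, and the transpose of qs the t boxes in the
  -- leftmost columns. Removing the rims lowers M by e + f and keeps t.
  data State (e f : ℕ) (ps qs : List ℕ) : Set where
    full : ∀ {M} → Shape e f M 0 ps → Shape f e M 0 qs → State e f ps qs
    part : ∀ i₀ j₀ {K t M} → i₀ < f → j₀ < e → 1 ≤ t → t ≤ K → M ≡ e * i₀ + f * j₀ + e * f * K →
      Shape e f M (j₀ + e * t) ps → Shape f e M (i₀ + f * t) qs → State e f ps qs

  module _ {e f M J : ℕ} where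

    below-shift : ∀ {M′} → M ≡ M′ + (e + f) → ∀ i j → Below e f M (suc J) (suc i) (suc j) → Below e f M′ J i j
    below-shift {M′} M≡ i j (inj₁ v<M)       = inj₁ (cert 0 (v<M ⊕ eq≤ M≡) (solve (e ∷ f ∷ M ∷ M′ ∷ i ∷ j ∷ [])))
    below-shift {M′} M≡ i j (inj₂ (v≡M , j<)) = inj₂ (lineq (v≡M ⊞ M≡) (solve (e ∷ f ∷ M ∷ M′ ∷ i ∷ j ∷ [])) , s≤s⁻¹ j<)

    below-unshift : ∀ {M′} → M ≡ M′ + (e + f) → ∀ i j → Below e f M′ J i j → Below e f M (suc J) (suc i) (suc j)
    below-unshift {M′} M≡ i j (inj₁ v<M)        = inj₁ (cert 0 (v<M ⊕ eq≥ M≡) (solve (e ∷ f ∷ M ∷ M′ ∷ i ∷ j ∷ [])))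
    below-unshift {M′} M≡ i j (inj₂ (v≡M , j<)) = inj₂ (lineq (v≡M ⊞ sym M≡) (solve (e ∷ f ∷ M ∷ M′ ∷ i ∷ j ∷ [])) , s≤s j<)

  below-full : ∀ e f {d N} → d ≡ e + f → ∀ i j → e * suc i + f * suc j < N → Below e f (N ∸ d) 0 i j
  below-full e f {d} {N} d≡ i j v<N = inj₁ (m+n≤o⇒m≤o∸n (suc (e * i + f * j)) sum≤)
    where
    sum≤ : suc (e * i + f * j) + d ≤ N
    sum≤ = cert 0 (v<N ⊕ eq≤ d≡) (solve (e ∷ f ∷ N ∷ d ∷ i ∷ j ∷ []))

  full-below : ∀ e f {d N} → d ≡ e + f → ∀ i j → Below e f (N ∸ d) 0 i j → e * suc i + f * suc j < N
  full-below e f {d} {N} d≡ i j (inj₁ v<) = sum< (room (d ≤? N))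
    where
    room : Dec (d ≤ N) → suc (e * i + f * j) + d ≤ N
    room (yes d≤N) = m≤o∸n⇒m+n≤o _ d≤N v<
    -- Here `N ∸ d` is truncated to 0, and no box lies below level 0.
    room (no d≰N)  = ⊥-elim (n≮0 (≤-trans v< (eq≤ (m≤n⇒m∸n≡0 (<⇒≤ (≰⇒> d≰N))))))
    sum< : suc (e * i + f * j) + d ≤ N → e * suc i + f * suc j < N
    sum< h = cert 0 (h ⊕ eq≥ d≡) (solve (e ∷ f ∷ N ∷ d ∷ i ∷ j ∷ []))

  -- Once K has dropped below t, all boxes of the last line belong to the diagram.
  below-saturated : ∀ {e f M i₀ j₀ K t z} → 1 ≤ e → i₀ < f → M + e * f * z ≡ e * suc i₀ + f * suc j₀ + e * f * K →
    K < z + t → ∀ i j → Below e f (suc M) 0 (suc i) (suc j) → Below e f M (suc j₀ + e * t) (suc i) (suc j)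
  below-saturated {e} {f} {M} {i₀} {j₀} {K} {t} {z} e≥1 i₀<f M≡ K< i j (inj₁ v≤M) with m≤n⇒m<n∨m≡n (s≤s⁻¹ v≤M)
  ... | inj₁ v<M = inj₁ v<M
  ... | inj₂ v≡M = inj₂ (v≡M , ≰⇒> outside)
    where
    outside : suc j₀ + e * t ≤ suc j → ⊥
    outside J≤j = absurd (e * i) (f ⊛ J≤j ⊕ (e * f) ⊛ K< ⊕ e ⊛ i₀<f ⊕ eq≤ M≡ ⊕ eq≤ v≡M ⊕ e≥1)
      (solve (e ∷ f ∷ M ∷ i₀ ∷ j₀ ∷ K ∷ t ∷ z ∷ i ∷ j ∷ []))

  saturated-below : ∀ e f {M J} i j → Below e f M J i j → e * i + f * j < suc M
  saturated-below e f i j (inj₁ v<M)       = s≤s (<⇒≤ v<M)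
  saturated-below e f i j (inj₂ (v≡M , _)) = s≤s (eq≤ v≡M)

  column-∤ : ∀ {d A C R} → (d ∣ A → ⊥) → A + 1 ≡ C + R → 1 ≤ C → mullineuxColumn d (A , R) ≡ (A , C)
  column-∤ {d} {A} {suc C} {R} d∤A A≡ _ with d ∣? A
  ... | yes d∣A = ⊥-elim (d∤A d∣A)
  ... | no _    = cong (A ,_) (trans (+-comm (A ∸ R) 1) (cong suc A∸R))
    where
    A∸R : A ∸ R ≡ C
    A∸R = trans (cong (_∸ R) (suc-injective (trans (+-comm 1 A) A≡))) (m+n∸n≡m C R)

  column-∣ : ∀ {d A C R} → d ∣ A → A ≡ C + R → mullineuxColumn d (A , R) ≡ (A , C)
  column-∣ {d} {A} {C} {R} d∣A A≡ with d ∣? A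
  ... | yes _   = cong (A ,_) (trans (+-identityʳ (A ∸ R)) (trans (cong (_∸ R) A≡) (m+n∸n≡m C R)))
  ... | no d∤A = ⊥-elim (d∤A d∣A)

  module _ {e f d : ℕ} (e≥1 : 1 ≤ e) (f≥1 : 1 ≤ f) (d≡ : d ≡ e + f) where

    -- Both rim sizes are the same symmetric expression in the two lengths, so they agree; `L` is
    -- the case in which `d` divides them and Mullineux's correction is 0.
    column : ∀ {M J J′ L L′ ps qs} → Dec L → (L → L′) → (L′ → L) → (L → d ∣ length qs + length ps) →
      1 ≤ length qs → 1 ≤ M →
      PartStrip e f M J (length qs) d L ps → PartStrip f e M J′ (length ps) d L′ qs →
      mullineuxColumn d (rimSize d d ps , length ps) ≡ (rimSize d d qs , length qs)
    column {ps = ps} {qs} (yes l) to from div qs≥1 M≥1 P Q =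
      trans (column-∣ {d} (subst (d ∣_) (sym (PartStrip.size₀ P l)) (div l)) (PartStrip.size₀ P l))
            (cong (_, length qs) (trans (PartStrip.size₀ P l)
              (trans (+-comm (length qs) (length ps)) (sym (PartStrip.size₀ Q (to l))))))
    column {ps = ps} {qs} (no ¬l) to from div qs≥1 M≥1 P Q =
      trans (column-∤ {d} (count-∤ e≥1 f≥1 M≥1 (PartStrip.rows Q) (PartStrip.rows P) d≡ (PartStrip.size P ¬l))
              (PartStrip.size P ¬l) qs≥1)
            (cong (_, length qs) (+-cancelʳ-≡ 1 _ _ (trans (PartStrip.size P ¬l)
              (trans (+-comm (length qs) (length ps)) (sym (PartStrip.size Q (λ l → ¬l (from l))))))))

  full-strip : ∀ {e f d M C lam} → 1 ≤ e → d ≡ e + f → 1 ≤ length lam → IsCount e M C → Shape e f M 0 lam →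
    PartStrip e f M 0 C d ⊥ lam
  full-strip {e} {f} {_} {M} {C} {lam@(_ ∷ _)} e≥1 refl _ isC S = partStrip (proj₁ r) (length-count f (λ _ _ → z≤n) S)
    (λ _ → trans (proj₂ r) (cong (_+ length lam) (IsCount-unique {e} {M} (head-count e (λ _ _ → refl) S) isC))) (λ ())
    where r = strip-plain e≥1 (λ _ _ → refl) S

  last? : ∀ i₀ j₀ K t → Dec (Last i₀ j₀ K t)
  last? i₀ j₀ K t with i₀ ≟ 0 | j₀ ≟ 0 | t ≟ K
  ... | yes p | yes q | yes r = yes (p , q , r)
  ... | no p  | _     | _     = no λ l → p (proj₁ l)
  ... | _     | no q  | _     = no λ l → q (proj₁ (proj₂ l))
  ... | _     | _     | no r  = no λ l → r (proj₂ (proj₂ l))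

  last-swap : ∀ {i₀ j₀ K t} → Last i₀ j₀ K t → Last j₀ i₀ K t
  last-swap (p , q , r) = q , p , r

  module _ {e f d : ℕ} (e≥1 : 1 ≤ e) (f≥1 : 1 ≤ f) (e⊥f : Coprime e f) (d≡ : d ≡ e + f) where

    private
      d≡′ : d ≡ f + e
      d≡′ = trans d≡ (+-comm e f)
      d≥1 : 1 ≤ d
      d≥1 = ≤-trans e≥1 (≤-trans (m≤m+n e f) (eq≥ d≡))

    Step : List ℕ → List ℕ → Set
    Step ps qs = mullineuxColumn d (rimSize d d ps , length ps) ≡ (rimSize d d qs , length qs) ×
                 State e f (strip d ps) (strip d qs)

    step-full : ∀ {M ps qs} → 1 ≤ length ps → 1 ≤ length qs → Shape e f M 0 ps → Shape f e M 0 qs → Step ps qs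
    step-full {M} {ps} {qs} ps≥1 qs≥1 S S′ =
      column e≥1 f≥1 d≡ (no λ ()) (λ ()) (λ ()) (λ ()) qs≥1 M≥1 P Q ,
      full (strip-shape d≥1 (Shape.partition S) (PartStrip.strips P) (λ i j b → below-full e f d≡ i j (strict e f (suc i) (suc j) b)) (λ i j b → inj₁ (full-below e f d≡ i j b)))
           (strip-shape d≥1 (Shape.partition S′) (PartStrip.strips Q) (λ i j b → below-full f e d≡′ i j (strict f e (suc i) (suc j) b)) (λ i j b → inj₁ (full-below f e d≡′ i j b)))
      where
      strict : ∀ e f i j → Below e f M 0 i j → e * i + f * j < M
      strict e f i j (inj₁ v<M) = v<M
      P = full-strip e≥1 d≡ ps≥1 (length-count e (λ _ _ → z≤n) S′) S
      Q = full-strip f≥1 d≡′ qs≥1 (length-count f (λ _ _ → z≤n) S) S′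
      M≥1 : 1 ≤ M
      M≥1 = <-≤-trans (s≤s z≤n) (proj₁ (PartStrip.rows P) 0 ps≥1)

    step-part : ∀ i₀ j₀ {K t M ps qs} → 1 ≤ length ps → 1 ≤ length qs → i₀ < f → j₀ < e → 1 ≤ t → t ≤ K →
      M ≡ e * i₀ + f * j₀ + e * f * K → Shape e f M (j₀ + e * t) ps → Shape f e M (i₀ + f * t) qs → Step ps qs
    step-part i₀ j₀ {K} {t} {M} {ps} {qs} ps≥1 qs≥1 i₀<f j₀<e t≥1 t≤K M≡ S S′ =
      column e≥1 f≥1 d≡ (last? i₀ j₀ K t) last-swap last-swap multiple qs≥1 M≥1 P Q , next (borrow i₀ + borrow j₀ + t ≤? K)
      where
      M≡′ : M ≡ f * j₀ + e * i₀ + f * e * K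
      M≡′ = lineq M≡ (solve (e ∷ f ∷ i₀ ∷ j₀ ∷ K ∷ M ∷ []))
      P = part-strip {i₀ = i₀} j₀ e≥1 f≥1 e⊥f d≡ ps≥1 i₀<f j₀<e t≥1 t≤K M≡ (length-count e (part-late {f} {e} j₀ e≥1 M≡′ t≤K) S′) S
      Q = part-strip {i₀ = j₀} i₀ f≥1 e≥1 (Coprimality.sym e⊥f) d≡′ qs≥1 j₀<e i₀<f t≥1 t≤K M≡′ (length-count f (part-late {e} {f} i₀ f≥1 M≡ t≤K) S) S′
      M≥1 : 1 ≤ M
      M≥1 = <-≤-trans (s≤s z≤n) (proj₁ (PartStrip.rows P) 0 ps≥1)
      multiple : Last i₀ j₀ K t → d ∣ length qs + length ps
      multiple (refl , refl , _) = divides K (trans (cong₂ _+_ qs≡ ps≡) total)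
        where
        M≡e : M ≡ e * (f * K)
        M≡e = lineq M≡ (solve (e ∷ f ∷ K ∷ M ∷ []))
        M≡f : M ≡ f * (e * K)
        M≡f = lineq M≡ (solve (e ∷ f ∷ K ∷ M ∷ []))
        qs≡ : length qs ≡ f * K
        qs≡ = IsCount-unique {e} {M} (PartStrip.rows Q) (IsCount-multiple e≥1 M≡e)
        ps≡ : length ps ≡ e * K
        ps≡ = IsCount-unique {f} {M} (PartStrip.rows P) (IsCount-multiple f≥1 M≡f)
        total : f * K + e * K ≡ K * d
        total = lineq (K ⊠ sym d≡) (solve (e ∷ f ∷ K ∷ d ∷ []))
      i₁ = prev f i₀
      j₁ = prev e j₀
      -- M written with the first boxes of the two borders, borrowing e f where a border is reached.
      borrowed : ∀ x y i₁ j₁ → i₀ + f * x ≡ suc i₁ → j₀ + e * y ≡ suc j₁ →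
        M + e * f * (x + y) ≡ e * suc i₁ + f * suc j₁ + e * f * K
      borrowed x y i₁ j₁ I I′ = lineq (M≡ ⊞ e ⊠ I ⊞ f ⊠ I′) (solve (e ∷ f ∷ i₀ ∷ j₀ ∷ K ∷ M ∷ x ∷ y ∷ i₁ ∷ j₁ ∷ []))
      M+ : M + e * f * (borrow i₀ + borrow j₀) ≡ e * suc i₁ + f * suc j₁ + e * f * K
      M+ = borrowed (borrow i₀) (borrow j₀) i₁ j₁ (prev-suc i₀ f≥1) (prev-suc j₀ e≥1)
      M+′ : ∀ z i₁ j₁ → M + e * f * z ≡ e * suc i₁ + f * suc j₁ + e * f * K →
            M + f * e * z ≡ f * suc j₁ + e * suc i₁ + f * e * K
      M+′ z i₁ j₁ h = lineq h (solve (e ∷ f ∷ K ∷ M ∷ z ∷ i₁ ∷ j₁ ∷ []))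
      lower : ∀ z K′ i₁ j₁ → z + K′ ≡ K → M + e * f * z ≡ e * suc i₁ + f * suc j₁ + e * f * K →
              M ≡ e * i₁ + f * j₁ + e * f * K′ + (e + f)
      lower z K′ i₁ j₁ Z h = lineq (h ⊞ e * f ⊠ sym Z) (solve (e ∷ f ∷ K ∷ K′ ∷ M ∷ z ∷ i₁ ∷ j₁ ∷ []))
      next : Dec (borrow i₀ + borrow j₀ + t ≤ K) → State e f (strip d ps) (strip d qs)
      next (yes z+t≤K) = part i₁ j₁ {K = K ∸ z} (prev-< i₀<f) (prev-< j₀<e) t≥1 (m+n≤o⇒n≤o∸m z z+t≤K) refl
          (strip-shape d≥1 (Shape.partition S) (PartStrip.strips P) (below-shift {e} {f} M≡₁) (below-unshift {e} {f} M≡₁))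
          (strip-shape d≥1 (Shape.partition S′) (PartStrip.strips Q) (below-shift {f} {e} M≡₂) (below-unshift {f} {e} M≡₂))
        where
        z = borrow i₀ + borrow j₀
        m+n≤o⇒n≤o∸m : ∀ m {n o} → m + n ≤ o → n ≤ o ∸ m
        m+n≤o⇒n≤o∸m m {n} h = m+n≤o⇒m≤o∸n n (≤-trans (eq≤ (+-comm n m)) h)
        M≡₁ : M ≡ e * i₁ + f * j₁ + e * f * (K ∸ z) + (e + f)
        M≡₁ = lower z (K ∸ z) i₁ j₁ (m+[n∸m]≡n (≤-trans (m≤m+n z t) z+t≤K)) M+
        M≡₂ : M ≡ e * i₁ + f * j₁ + e * f * (K ∸ z) + (f + e)
        M≡₂ = trans M≡₁ (cong (e * i₁ + f * j₁ + e * f * (K ∸ z) +_) (+-comm e f))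
      -- At most `t` boxes are left on the lowered line, so both diagrams contain all of them;
      -- passing from `M` to `suc M` counts them among the boxes strictly below.
      next (no z+t≰K) = full
          (strip-shape d≥1 (Shape.partition S) (PartStrip.strips P)
            (λ i j b → below-full e f d≡ i j (saturated-below e f (suc i) (suc j) b))
            (λ i j b → below-saturated e≥1 (prev-< i₀<f) M+ (≰⇒> z+t≰K) i j (inj₁ (full-below e f d≡ i j b))))
          (strip-shape d≥1 (Shape.partition S′) (PartStrip.strips Q)
            (λ i j b → below-full f e d≡′ i j (saturated-below f e (suc i) (suc j) b))
            (λ i j b → below-saturated f≥1 (prev-< j₀<e) (M+′ (borrow i₀ + borrow j₀) i₁ j₁ M+) (≰⇒> z+t≰K) i j (inj₁ (full-below f e d≡′ i j b))))

    step : ∀ {ps qs} → 1 ≤ length ps → 1 ≤ length qs → State e f ps qs → Step ps qs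
    step ps≥1 qs≥1 (full S S′) = step-full ps≥1 qs≥1 S S′
    step ps≥1 qs≥1 (part i₀ j₀ i₀<f j₀<e t≥1 t≤K M≡ S S′) = step-part i₀ j₀ ps≥1 qs≥1 i₀<f j₀<e t≥1 t≤K M≡ S S′

  -- The Mullineux map of a diagram below a line

  shape-nonempty : ∀ {e f M J ps} → 1 ≤ M → Shape e f M J ps → 1 ≤ length ps
  shape-nonempty {e} {f} {M} {J} {ps} M≥1 S = length-at ps (Shape.covers S 0 0 (inj₁ (cert 0 M≥1 (solve (e ∷ f ∷ M ∷ [])))))

  part-level : ∀ {e f i₀ j₀ K t M} → 1 ≤ e → 1 ≤ f → 1 ≤ t → t ≤ K → M ≡ e * i₀ + f * j₀ + e * f * K → 1 ≤ M
  part-level {e} {f} {i₀} {j₀} {K} e≥1 f≥1 t≥1 t≤K M≡ =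
    ≤-trans (≤-trans (*-mono-≤ (*-mono-≤ e≥1 f≥1) (≤-trans t≥1 t≤K)) (m≤n+m (e * f * K) (e * i₀ + f * j₀))) (eq≥ M≡)

  module _ {e f d : ℕ} (e≥1 : 1 ≤ e) (f≥1 : 1 ≤ f) (e⊥f : Coprime e f) (d≡ : d ≡ e + f) where

    state-nonempty : ∀ {p ps qs} → State e f (p ∷ ps) qs → 1 ≤ length qs
    state-nonempty {p} (full {M} S S′) = shape-nonempty (level (Shape.inside S 0 0 (Partition-head (Shape.partition S)))) S′
      where
      level : Below e f M 0 0 0 → 1 ≤ M
      level (inj₁ v<M) = <-≤-trans (s≤s z≤n) v<M
    state-nonempty (part _ _ _ _ t≥1 t≤K M≡ S S′) = shape-nonempty (part-level e≥1 f≥1 t≥1 t≤K M≡) S′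

    state-nonempty′ : ∀ {ps q qs} → State e f ps (q ∷ qs) → 1 ≤ length ps
    state-nonempty′ {q = q} (full {M} S S′) = shape-nonempty (level (Shape.inside S′ 0 0 (Partition-head (Shape.partition S′)))) S
      where
      level : Below f e M 0 0 0 → 1 ≤ M
      level (inj₁ v<M) = <-≤-trans (s≤s z≤n) v<M
    state-nonempty′ (part _ _ _ _ t≥1 t≤K M≡ S S′) = shape-nonempty (part-level e≥1 f≥1 t≥1 t≤K M≡) S

    state-partitions : ∀ {ps qs} → State e f ps qs → Partition ps × Partition qs
    state-partitions (full S S′)               = Shape.partition S , Shape.partition S′
    state-partitions (part _ _ _ _ _ _ _ S S′) = Shape.partition S , Shape.partition S′

    state-symbol : ∀ k {ps qs} → State e f ps qs →
      map (mullineuxColumn d) (mullineuxSymbolGo d k ps) ≡ mullineuxSymbolGo d k qs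
    state-symbol zero    _ = refl
    state-symbol (suc k) {[]}     {[]}     _ = refl
    state-symbol (suc k) {[]}     {_ ∷ _}  s = ⊥-elim (n≮0 (state-nonempty′ s))
    state-symbol (suc k) {_ ∷ _}  {[]}     s = ⊥-elim (n≮0 (state-nonempty s))
    state-symbol (suc k) {p ∷ ps} {q ∷ qs} s with step e≥1 f≥1 e⊥f d≡ (s≤s z≤n) (s≤s z≤n) s
    ... | c , s′ = cong₂ _∷_ c (state-symbol k s′)

    state-sum : ∀ k {ps qs} → sum ps ≤ k → State e f ps qs → sum ps ≡ sum qs
    state-sum k {[]}     {[]}     _ _ = refl
    state-sum k {[]}     {_ ∷ _}  _ s = ⊥-elim (n≮0 (state-nonempty′ s))
    state-sum k {_ ∷ _}  {[]}     _ s = ⊥-elim (n≮0 (state-nonempty s))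
    state-sum zero    {p ∷ ps} {q ∷ qs} ps≤k s =
      ⊥-elim (<⇒≱ (Partition-head (proj₁ (state-partitions s))) (≤-trans (m≤m+n p (sum ps)) ps≤k))
    state-sum (suc k) {p ∷ ps} {q ∷ qs} ps≤k s with step e≥1 f≥1 e⊥f d≡ (s≤s z≤n) (s≤s z≤n) s
    ... | c , s′ = trans (sym (strip-sum {d} π)) (trans (cong₂ _+_
          (state-sum k (s≤s⁻¹ (≤-trans (strip-sum< d≥1 π) ps≤k)) s′) (cong proj₁ c)) (strip-sum {d} ρ))
      where
      π = proj₁ (state-partitions s)
      ρ = proj₂ (state-partitions s)
      d≥1 : 1 ≤ d
      d≥1 = ≤-trans e≥1 (≤-trans (m≤m+n e f) (eq≥ d≡))

  -- Regularity

  ≢⇒≡ᵇ-false : ∀ {m n} → m ≢ n → (m ≡ᵇ n) ≡ false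
  ≢⇒≡ᵇ-false {zero}  {zero}  m≢n = ⊥-elim (m≢n refl)
  ≢⇒≡ᵇ-false {zero}  {suc n} _   = refl
  ≢⇒≡ᵇ-false {suc m} {zero}  _   = refl
  ≢⇒≡ᵇ-false {suc m} {suc n} m≢n = ≢⇒≡ᵇ-false λ m≡n → m≢n (cong suc m≡n)

  countEq-≤ : ∀ {p} c lam → Partition lam → at lam c < p → countEq p lam ≤ c
  countEq-≤ c [] _ _ = z≤n
  countEq-≤ {p} zero (q ∷ qs) π q<p
    rewrite ≢⇒≡ᵇ-false {p} {q} (>⇒≢ q<p) = countEq-≤ zero qs (Partition-tail π) (≤-<-trans (Partition⇒Decreasing π 0) q<p)
  countEq-≤ {p} (suc c) (q ∷ qs) π h = +-mono-≤ (one≤ (p ≡ᵇ q)) (countEq-≤ c qs (Partition-tail π) h)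
    where
    one≤ : ∀ b → (if b then 1 else 0) ≤ 1
    one≤ true  = ≤-refl
    one≤ false = z≤n

  regular-count : ∀ {c} lam → Partition lam → (∀ j → 1 ≤ at lam j → at lam (c + j) < at lam j) →
    ∀ p → countEq p lam ≤ c
  regular-count [] _ _ p = z≤n
  regular-count {c} (q ∷ qs) π h p with p ≟ q
  ... | yes refl = countEq-≤ c (q ∷ qs) π (≤-trans (s≤s (eq≤ (cong (at (q ∷ qs)) (sym (+-identityʳ c))))) (h 0 (Partition-head π)))
  ... | no p≢q rewrite ≢⇒≡ᵇ-false p≢q = regular-count qs (Partition-tail π)
    (λ j j≥1 → ≤-trans (s≤s (eq≤ (cong (at (q ∷ qs)) (sym (+-suc c j))))) (h (suc j) j≥1)) p

  countEq⇒regular : ∀ d lam → (∀ p → countEq p lam < d) → isRegular d lam ≡ true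
  countEq⇒regular d lam h = go lam
    where
    go : ∀ ps → foldr (λ p r → (countEq p lam <ᵇ d) ∧ r) true ps ≡ true
    go []       = refl
    go (p ∷ ps) rewrite go ps = trans (cong (_∧ true) (Equivalence.to T-≡ (<⇒<ᵇ (h p)))) refl

  -- Going down `d - 1` rows raises the value by `f * (d - 1)`, which is at least `e`, the cost of
  -- one step to the right. So row `j + d - 1` is shorter than a nonempty row `j`, and no part
  -- occurs `d` times.
  shape-regular : ∀ {e f M J d lam} → 1 ≤ e → 1 ≤ f → d ≡ e + f → Shape e f M J lam → isRegular d lam ≡ true
  shape-regular {suc e} {suc f} {M} {J} {d} {lam} _ _ refl S = countEq⇒regular _ lam λ p →
    s≤s (≤-trans (regular-count {e + suc f} lam (Shape.partition S) drop p) ≤-refl)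
    where
    drop : ∀ j → 1 ≤ at lam j → at lam (e + suc f + j) < at lam j
    drop j at≥1 = below (at lam j ∸ 1) (m+[n∸m]≡n at≥1)
      where
      below : ∀ x → suc x ≡ at lam j → at lam (e + suc f + j) < at lam j
      below x x≡ = ≤-trans (s≤s (≮⇒≥ λ lt → clash (Shape.inside S x (e + suc f + j) lt))) (eq≤ x≡)
        where
        out : M ≤ suc e * suc x + suc f * j
        out = outside-≥ S (suc x) j (eq≥ x≡)
        clash : Below (suc e) (suc f) M J x (e + suc f + j) → ⊥
        -- The slack is `f * (d - 1) - e = d * (f - 1)`, written with `e` and `f` lowered by one.
        clash (inj₁ v<M) = absurd (f * e + f * f + 2 * f) (v<M ⊕ out) (solve (e ∷ f ∷ x ∷ j ∷ M ∷ []))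
        clash (inj₂ (v≡M , lt)) = absurd (f * e + f * f + 2 * f) (eq≤ v≡M ⊕ out′) (solve (e ∷ f ∷ x ∷ j ∷ M ∷ []))
          where
          out′ : M < suc e * suc x + suc f * j
          out′ = outside-> S (suc x) j (eq≥ x≡) (≤-<-trans (m≤n+m j (e + suc f)) lt)

  -- Uniqueness of the partition with a given symbol

  partsGo-complete : ∀ f n m lam → Partition lam → at lam 0 ≤ m → sum lam ≡ n → n ≤ f → lam ∈ partsGo f n m
  partsGo-complete f zero m [] _ _ _ _ = here refl
  partsGo-complete f zero m (suc p ∷ ps) _ _ () _
  partsGo-complete f n m (zero ∷ ps) π _ _ _ = ⊥-elim (n≮0 (Partition-head π))
  partsGo-complete (suc f) (suc n) m (suc p ∷ ps) π p<m s≡ (s≤s n≤f) = ∈-concatMap⁺ _ {xs = map suc (upTo (suc n ⊓ m))}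
    (lose (∈-map⁺ suc (∈-upTo⁺ (⊓-glb (≤-trans (s≤s (m≤m+n p (sum ps))) (eq≤ s≡)) p<m)))
      (∈-map⁺ (suc p ∷_) (partsGo-complete f (n ∸ p) (suc p) ps (Partition-tail π) (Partition⇒Decreasing π 0)
        (sym (trans (cong (_∸ p) (sym (suc-injective s≡))) (m+n∸m≡n p (sum ps)))) (≤-trans (m∸n≤m n p) n≤f))))

  partsGo-sound : ∀ f n m lam → lam ∈ partsGo f n m → Partition lam × at lam 0 ≤ m × sum lam ≡ n
  partsGo-sound f zero m lam (here refl) = none , z≤n , refl
  partsGo-sound zero (suc n) m lam ()
  partsGo-sound (suc f) (suc n) m lam h with find (∈-concatMap⁻ (λ p → map (p ∷_) (partsGo f (suc n ∸ p) p)) {xs = map suc (upTo (suc n ⊓ m))} h)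
  ... | p , p∈ , lam∈ with ∈-map⁻ suc p∈ | ∈-map⁻ (p ∷_) lam∈
  ...   | p′ , p′∈ , refl | ps , ps∈ , refl with partsGo-sound f (n ∸ p′) (suc p′) ps ps∈
  ...     | π , ps≤ , s≡ = Partition-∷ (s≤s z≤n) ps≤ π , ≤-trans (∈-upTo⁻ p′∈) (m⊓n≤n (suc n) m) ,
            cong suc (trans (cong (p′ +_) s≡) (m+[n∸m]≡n (s≤s⁻¹ (≤-trans (∈-upTo⁻ p′∈) (m⊓n≤m (suc n) m)))))

  headMaybe-filter : {A : Set} {P : A → Set} (P? : ∀ x → Dec (P x)) {y : A} (xs : List A) →
    y ∈ xs → P y → (∀ x → x ∈ xs → P x → x ≡ y) → headMaybe (filter P? xs) ≡ just y
  headMaybe-filter P? (x ∷ xs) y∈ py unique with P? x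
  ... | yes px = cong just (unique x (here refl) px)
  headMaybe-filter P? (x ∷ xs) (here refl) py unique | no ¬px = ⊥-elim (¬px py)
  headMaybe-filter P? (x ∷ xs) (there y∈) py unique | no _ = headMaybe-filter P? xs y∈ py λ z z∈ → unique z (there z∈)

  symbolEq-refl : ∀ {s t} → s ≡ t → T (symbolEqᵇ s t)
  symbolEq-refl s≡t = fromWitness s≡t

  symbolEq⇒≡ : ∀ s t → T (symbolEqᵇ s t) → s ≡ t
  symbolEq⇒≡ s t = toWitness

  mullineux-unique : ∀ {d ps qs} → 1 ≤ d → Partition qs → sum ps ≡ sum qs →
    isRegular d ps ≡ true → isRegular d qs ≡ true →
    map (mullineuxColumn d) (mullineuxSymbol d ps) ≡ mullineuxSymbol d qs → mullineux d ps ≡ just qs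
  mullineux-unique {d} {ps} {qs} d≥1 ρ sum≡ reg-ps reg-qs symbol≡ rewrite reg-ps =
    headMaybe-filter _ (partitionsOf (sum ps)) member (Equivalence.from T-∧ (Equivalence.from T-≡ reg-qs , symbolEq-refl (sym symbol≡))) unique
    where
    head≤ : ∀ lam → at lam 0 ≤ sum lam
    head≤ []       = z≤n
    head≤ (p ∷ lam) = m≤m+n p (sum lam)
    member : qs ∈ partitionsOf (sum ps)
    member = partsGo-complete _ _ _ qs ρ (≤-trans (head≤ qs) (eq≥ sum≡)) (sym sum≡) ≤-refl
    unique : ∀ μ → μ ∈ partitionsOf (sum ps) →
      T (isRegular d μ ∧ symbolEqᵇ (mullineuxSymbol d μ) (map (mullineuxColumn d) (mullineuxSymbol d ps))) → μ ≡ qs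
    unique μ μ∈ ok with partsGo-sound _ _ _ μ μ∈
    ... | π , _ , s≡ = symbol-injective (sum qs) μ qs d≥1 π ρ (eq≤ sumμ) ≤-refl
        (trans (cong (λ k → mullineuxSymbolGo d k μ) (sym sumμ))
          (trans (symbolEq⇒≡ (mullineuxSymbol d μ) _ (proj₂ (Equivalence.to T-∧ ok))) symbol≡))
      where
      sumμ : sum μ ≡ sum qs
      sumμ = trans s≡ sum≡

  module _ {e f d : ℕ} (e≥1 : 1 ≤ e) (f≥1 : 1 ≤ f) (e⊥f : Coprime e f) (d≡ : d ≡ e + f) where

    state-mullineux : ∀ {ps qs} → State e f ps qs → mullineux d ps ≡ just qs × sum ps ≡ sum qs
    state-mullineux {ps} {qs} s =
      mullineux-unique d≥1 (proj₂ (state-partitions e≥1 f≥1 e⊥f d≡ s)) sum≡ (proj₁ (regular s)) (proj₂ (regular s))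
        (trans (state-symbol e≥1 f≥1 e⊥f d≡ (sum ps) s) (cong (λ k → mullineuxSymbolGo d k qs) sum≡)) ,
      sum≡
      where
      d≥1 : 1 ≤ d
      d≥1 = ≤-trans e≥1 (≤-trans (m≤m+n e f) (eq≥ d≡))
      sum≡ : sum ps ≡ sum qs
      sum≡ = state-sum e≥1 f≥1 e⊥f d≡ (sum ps) ≤-refl s
      d≡′ : d ≡ f + e
      d≡′ = trans d≡ (+-comm e f)
      regular : State e f ps qs → isRegular d ps ≡ true × isRegular d qs ≡ true
      regular (full S S′)               = shape-regular e≥1 f≥1 d≡ S , shape-regular f≥1 e≥1 d≡′ S′
      regular (part _ _ _ _ _ _ _ S S′) = shape-regular e≥1 f≥1 d≡ S , shape-regular f≥1 e≥1 d≡′ S′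

  -- Transposition

  at-applyUpTo : ∀ g n {j} → j < n → at (applyUpTo g n) j ≡ g j
  at-applyUpTo g (suc n) {zero}  _         = refl
  at-applyUpTo g (suc n) {suc j} (s≤s j<n) = at-applyUpTo (λ i → g (suc i)) n j<n

  at-applyUpTo-≥ : ∀ g n {j} → n ≤ j → at (applyUpTo g n) j ≡ 0
  at-applyUpTo-≥ g zero    {j}     _         = refl
  at-applyUpTo-≥ g (suc n) {suc j} (s≤s n≤j) = at-applyUpTo-≥ (λ i → g (suc i)) n n≤j

  at-applyUpTo-0 : ∀ g n → (∀ j → n ≤ j → g j ≡ 0) → ∀ j → at (applyUpTo g n) j ≡ g j
  at-applyUpTo-0 g n vanish j with n ≤? j
  ... | yes n≤j = trans (at-applyUpTo-≥ g n n≤j) (sym (vanish j n≤j))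
  ... | no n≰j  = at-applyUpTo g n (≰⇒> n≰j)

  countGE-inside : ∀ j lam → Partition lam → ∀ i → i < countGE (suc j) lam → j < at lam i
  countGE-inside j (p ∷ ps) π i i< with j <ᵇ p in eq
  countGE-inside j (p ∷ ps) π zero i<          | true = <ᵇ⇒< j p (Equivalence.from T-≡ eq)
  countGE-inside j (p ∷ ps) π (suc i) (s≤s i<) | true = countGE-inside j ps (Partition-tail π) i i<
  countGE-inside j (p ∷ ps) π i i<             | false =
    <-≤-trans (countGE-inside j ps (Partition-tail π) i i<) (Partition⇒Decreasing π i)

  countGE-covers : ∀ j lam → Partition lam → ∀ i → j < at lam i → i < countGE (suc j) lam
  countGE-covers j (p ∷ ps) π i h with j <ᵇ p in eq
  countGE-covers j (p ∷ ps) π zero    h | true  = s≤s z≤n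
  countGE-covers j (p ∷ ps) π (suc i) h | true  = s≤s (countGE-covers j ps (Partition-tail π) i h)
  countGE-covers j (p ∷ ps) π i       h | false =
    ⊥-elim (subst T eq (<⇒<ᵇ (<-≤-trans h (Decreasing-≤ (p ∷ ps) (Partition⇒Decreasing π) {0} {i} z≤n))))

  transpose≡ : ∀ lam → transpose lam ≡ applyUpTo (λ j → countGE (suc j) lam) (firstPart lam)
  transpose≡ lam = trans (cong (map (λ j → countGE j lam)) (map-upTo suc (firstPart lam)))
    (map-applyUpTo suc (λ j → countGE j lam) (firstPart lam))

  firstPart≡ : ∀ lam → firstPart lam ≡ at lam 0
  firstPart≡ []      = refl
  firstPart≡ (_ ∷ _) = refl

  at-transpose : ∀ {lam} → Partition lam → ∀ j → at (transpose lam) j ≡ countGE (suc j) lam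
  at-transpose {lam} π j = trans (cong (λ l → at l j) (transpose≡ lam))
    (at-applyUpTo-0 _ (firstPart lam) (λ j ≤j → n≤0⇒n≡0 (≮⇒≥ λ c>0 →
      <⇒≱ (countGE-inside j lam π 0 c>0) (≤-trans (eq≥ (firstPart≡ lam)) ≤j))) j)

  transpose-inside : ∀ {lam} → Partition lam → ∀ i j → i < at (transpose lam) j → j < at lam i
  transpose-inside {lam} π i j h = countGE-inside j lam π i (≤-trans h (eq≤ (at-transpose π j)))

  transpose-covers : ∀ {lam} → Partition lam → ∀ i j → j < at lam i → i < at (transpose lam) j
  transpose-covers {lam} π i j h = ≤-trans (countGE-covers j lam π i h) (eq≥ (at-transpose π j))

  transpose-outside : ∀ {lam} → Partition lam → ∀ i j → at (transpose lam) j ≤ i → at lam i ≤ j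
  transpose-outside π i j ≤i = ≮⇒≥ λ lt → <⇒≱ (transpose-covers π i j lt) ≤i

  Partition-intro : ∀ ps → (∀ j → j < length ps → 1 ≤ at ps j) → Decreasing ps → Partition ps
  Partition-intro [] _ _ = none
  Partition-intro (p ∷ ps) pos δ = Partition-∷ (pos 0 (s≤s z≤n)) (δ 0)
    (Partition-intro ps (λ j j< → pos (suc j) (s≤s j<)) (λ j → δ (suc j)))

  transpose-partition : ∀ {lam} → Partition lam → Partition (transpose lam)
  transpose-partition {lam} π = Partition-intro (transpose lam)
    (λ j j< → transpose-covers π 0 j (≤-trans j< (eq≤ (trans (trans (cong length (transpose≡ lam))
       (length-applyUpTo _ (firstPart lam))) (firstPart≡ lam)))))
    (λ j → ≮⇒≥ λ lt → <-irrefl refl (transpose-covers π _ j (<-trans (n<1+n j) (transpose-inside π _ (suc j) lt))))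

  sum-applyUpTo-+ : ∀ g h n → sum (applyUpTo (λ j → g j + h j) n) ≡ sum (applyUpTo g n) + sum (applyUpTo h n)
  sum-applyUpTo-+ g h zero    = refl
  sum-applyUpTo-+ g h (suc n) = trans (cong (g 0 + h 0 +_) (sum-applyUpTo-+ (λ j → g (suc j)) (λ j → h (suc j)) n))
    (shuffle (g 0) (h 0) _ _)
    where
    shuffle : ∀ a b c d → a + b + (c + d) ≡ a + c + (b + d)
    shuffle = solve-∀

  sum-indicator : ∀ p n → p ≤ n → sum (applyUpTo (λ j → if suc j ≤ᵇ p then 1 else 0) n) ≡ p
  sum-indicator p       zero    p≤n       = sym (n≤0⇒n≡0 p≤n)
  sum-indicator zero    (suc n) _         = sum-indicator zero n z≤n
  sum-indicator (suc p) (suc n) (s≤s p≤n) = cong suc (sum-indicator p n p≤n)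

  sum-countGE : ∀ lam n → Partition lam → at lam 0 ≤ n → sum (applyUpTo (λ j → countGE (suc j) lam) n) ≡ sum lam
  sum-countGE [] zero _ _ = refl
  sum-countGE [] (suc n) _ _ = sum-countGE [] n none z≤n
  sum-countGE (p ∷ ps) n π p≤n = trans (sum-applyUpTo-+ (λ j → if suc j ≤ᵇ p then 1 else 0) (λ j → countGE (suc j) ps) n)
    (cong₂ _+_ (sum-indicator p n p≤n) (sum-countGE ps n (Partition-tail π) (≤-trans (Partition⇒Decreasing π 0) p≤n)))

  transpose-sum : ∀ {lam} → Partition lam → sum (transpose lam) ≡ sum lam
  transpose-sum {lam} π = trans (cong sum (transpose≡ lam)) (sum-countGE lam (firstPart lam) π (eq≥ (firstPart≡ lam)))

  cut : (P : ℕ → Set) → (∀ i → Dec (P i)) → (∀ {i k} → i ≤ k → P k → P i) → ∀ b → ¬ P b →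
    ∃[ m ] (∀ i → i < m → P i) × (∀ i → P i → i < m)
  cut P P? down zero    ¬pb = 0 , (λ _ ()) , λ i pi → ⊥-elim (¬pb (down z≤n pi))
  cut P P? down (suc b) ¬pb with P? b
  ... | yes pb = suc b , (λ i i≤b → down (s≤s⁻¹ i≤b) pb) , λ i pi → ≰⇒> λ b<i → ¬pb (down b<i pi)
  ... | no ¬p  = cut P P? down b ¬p

  module _ {e f : ℕ} (e≥1 : 1 ≤ e) (f≥1 : 1 ≤ f) where

    below? : ∀ M J i j → Dec (Below e f M J i j)
    below? M J i j with e * i + f * j <? M | e * i + f * j ≟ M | j <? J
    ... | yes v<M | _       | _       = yes (inj₁ v<M)
    ... | no _    | yes v≡M | yes j<J = yes (inj₂ (v≡M , j<J))
    ... | no v≮M  | no v≢M  | _       = no λ { (inj₁ v<M) → v≮M v<M ; (inj₂ (v≡M , _)) → v≢M v≡M }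
    ... | no v≮M  | _       | no j≮J  = no λ { (inj₁ v<M) → v≮M v<M ; (inj₂ (_ , j<J)) → j≮J j<J }

    below-down : ∀ {M J i i′ j j′} → i ≤ i′ → j ≤ j′ → Below e f M J i′ j′ → Below e f M J i j
    below-down i≤ j≤ (inj₁ v<M) = inj₁ (≤-<-trans (e ⊛ i≤ ⊕ f ⊛ j≤) v<M)
    below-down i≤ j≤ (inj₂ (v≡M , j<J)) with m≤n⇒m<n∨m≡n (≤-trans (e ⊛ i≤ ⊕ f ⊛ j≤) (eq≤ v≡M))
    ... | inj₁ v<M  = inj₁ v<M
    ... | inj₂ v≡M′ = inj₂ (v≡M′ , ≤-<-trans j≤ j<J)

    below-level : ∀ {M J i j} → Below e f M J i j → e * i + f * j ≤ M
    below-level (inj₁ v<M)       = <⇒≤ v<M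
    below-level (inj₂ (v≡M , _)) = eq≤ v≡M

    private
      row : ∀ M J j → ∃[ m ] (∀ i → i < m → Below e f M J i j) × (∀ i → Below e f M J i j → i < m)
      row M J j = cut (λ i → Below e f M J i j) (λ i → below? M J i j) (λ i≤ → below-down i≤ ≤-refl) (suc M)
        λ b → <⇒≱ (≤-trans (s≤s ≤-refl) (≤-trans (≤-trans (m≤n*m (suc M) e {{>-nonZero e≥1}}) (m≤m+n _ _)) (below-level b))) ≤-refl

    shape-exists : ∀ M J → ∃[ lam ] Shape e f M J lam
    shape-exists M J = dropZeros ps , shape (dropZeros-partition ps δ)
      (λ i j i< → proj₁ (proj₂ (row M J j)) i (≤-trans i< (eq≤ (at≡ j))))
      (λ i j b → ≤-trans (proj₂ (proj₂ (row M J j)) i b) (eq≥ (at≡ j)))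
      where
      ℓ : ℕ → ℕ
      ℓ j = proj₁ (row M J j)
      ps : List ℕ
      ps = applyUpTo ℓ (suc M)
      vanish : ∀ j → suc M ≤ j → ℓ j ≡ 0
      vanish j M<j = n≤0⇒n≡0 (≮⇒≥ λ ℓ>0 → <⇒≱ M<j (≤-trans (≤-trans (m≤n*m j f {{>-nonZero f≥1}}) (m≤n+m (f * j) (e * 0)))
        (below-level (proj₁ (proj₂ (row M J j)) 0 ℓ>0))))
      ps-at : ∀ j → at ps j ≡ ℓ j
      ps-at = at-applyUpTo-0 ℓ (suc M) vanish
      δ : Decreasing ps
      δ j = ≤-trans (eq≤ (ps-at (suc j))) (≤-trans (≮⇒≥ λ lt → <-irrefl refl (proj₂ (proj₂ (row M J j)) _
        (below-down ≤-refl (n≤1+n j) (proj₁ (proj₂ (row M J (suc j))) _ lt)))) (eq≥ (ps-at j)))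
      at≡ : ∀ j → at (dropZeros ps) j ≡ ℓ j
      at≡ j = trans (dropZeros-at ps δ j) (ps-at j)

  -- Crossing a wall

  -- Every box of lam precedes every box outside lam, for slopes just before and just after the wall.
  BeforeWall AfterWall : (e f : ℕ) → List ℕ → Set
  BeforeWall e f lam = ∀ i j i′ j′ → i < at lam j → at lam j′ ≤ i′ →
    e * i + f * j < e * i′ + f * j′ ⊎ (e * i + f * j ≡ e * i′ + f * j′ × j < j′)
  AfterWall e f lam = ∀ i j i′ j′ → i < at lam j → at lam j′ ≤ i′ →
    e * i + f * j < e * i′ + f * j′ ⊎ (e * i + f * j ≡ e * i′ + f * j′ × i < i′)

  lex⇒≤ : ∀ {x y} {P : Set} → x < y ⊎ (x ≡ y × P) → x ≤ y
  lex⇒≤ (inj₁ lt)      = <⇒≤ lt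
  lex⇒≤ (inj₂ (p , _)) = eq≤ p

  -- Ties go to the smallest index, so that among the first outside boxes of all rows the one found
  -- comes first in the order before the wall.
  first-minimum : (g : ℕ → ℕ) (n : ℕ) → ∃[ k ] k ≤ n × (∀ j → j ≤ n → g k < g j ⊎ (g k ≡ g j × k ≤ j))
  first-minimum g zero = 0 , z≤n , λ { zero _ → inj₂ (refl , ≤-refl) }
  first-minimum g (suc n) with first-minimum g n
  ... | k , k≤n , min with g k ≤? g (suc n)
  ...   | yes gk≤ = k , ≤-trans k≤n (n≤1+n n) , λ j j≤ → extend j (m≤n⇒m<n∨m≡n j≤) (m≤n⇒m<n∨m≡n gk≤)
    where
    extend : ∀ j → j < suc n ⊎ j ≡ suc n → g k < g (suc n) ⊎ g k ≡ g (suc n) → g k < g j ⊎ (g k ≡ g j × k ≤ j)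
    extend j (inj₁ j<) _ = min j (s≤s⁻¹ j<)
    extend j (inj₂ refl) (inj₁ lt) = inj₁ lt
    extend j (inj₂ refl) (inj₂ eq) = inj₂ (eq , ≤-trans k≤n (n≤1+n n))
  ...   | no gk≰ = suc n , ≤-refl , λ j j≤ → extend j (m≤n⇒m<n∨m≡n j≤)
    where
    extend : ∀ j → j < suc n ⊎ j ≡ suc n → g (suc n) < g j ⊎ (g (suc n) ≡ g j × suc n ≤ j)
    extend j (inj₂ refl) = inj₂ (refl , ≤-refl)
    extend j (inj₁ j<) with min j (s≤s⁻¹ j<)
    ... | inj₁ lt       = inj₁ (<-trans (≰⇒> gk≰) lt)
    ... | inj₂ (eq , _) = inj₁ (<-≤-trans (≰⇒> gk≰) (eq≤ eq))

  module _ {e f : ℕ} (e≥1 : 1 ≤ e) (f≥1 : 1 ≤ f) where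

    -- M and J are read off the first box outside the diagram.
    beforeWall-shape : ∀ {lam} → Partition lam → BeforeWall e f lam →
      ∃[ J ] Shape e f (e * at lam J + f * J) J lam
    beforeWall-shape {lam} π before with first-minimum (λ j → e * at lam j + f * j) (length lam)
    ... | J , _ , min = J , shape π (λ i j i< → before i j (at lam J) J i< ≤-refl) (λ i j b → ≰⇒> λ ≤i → clash i j b ≤i (minimal j))
      where
      minimal : ∀ j → e * at lam J + f * J < e * at lam j + f * j ⊎ (e * at lam J + f * J ≡ e * at lam j + f * j × J ≤ j)
      minimal j with j ≤? length lam
      ... | yes j≤ = min j j≤
      ... | no j≰  = inj₁ (beyond (min (length lam) ≤-refl))
        where
        end : at lam (length lam) ≡ 0
        end = n≤0⇒n≡0 (≮⇒≥ λ h → <-irrefl refl (length-at lam h))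
        beyond : e * at lam J + f * J < e * at lam (length lam) + f * length lam ⊎
                 (e * at lam J + f * J ≡ e * at lam (length lam) + f * length lam × J ≤ length lam) →
                 e * at lam J + f * J < e * at lam j + f * j
        beyond h = ≤-<-trans (lex⇒≤ h) (≤-<-trans (eq≤ (trans (cong (λ x → e * x + f * length lam) end) (cong (_+ f * length lam) (*-zeroʳ e))))
                     (<-≤-trans (scale-< f≥1 (≰⇒> j≰)) (m≤n+m (f * j) (e * at lam j))))
      clash : ∀ i j → Below e f (e * at lam J + f * J) J i j → at lam j ≤ i →
        e * at lam J + f * J < e * at lam j + f * j ⊎ (e * at lam J + f * J ≡ e * at lam j + f * j × J ≤ j) → ⊥
      clash i j (inj₁ v<M) ≤i (inj₁ M<)       = <-asym v<M (<-≤-trans M< (+-monoˡ-≤ (f * j) (e ⊛ ≤i)))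
      clash i j (inj₁ v<M) ≤i (inj₂ (M≡ , _)) = <-irrefl refl (<-≤-trans v<M (≤-trans (eq≤ M≡) (+-monoˡ-≤ (f * j) (e ⊛ ≤i))))
      clash i j (inj₂ (v≡M , _)) ≤i (inj₁ M<) = <-irrefl (sym v≡M) (<-≤-trans M< (+-monoˡ-≤ (f * j) (e ⊛ ≤i)))
      clash i j (inj₂ (_ , j<J)) ≤i (inj₂ (_ , J≤j)) = <⇒≱ j<J J≤j

    -- Transposition turns the cut-off of the line by rows into one by columns, which is the tie
    -- rule after the wall.
    shape-afterWall : ∀ {M J qs} → Shape f e M J qs → AfterWall e f (transpose qs)
    shape-afterWall {M} {J} {qs} S i j i′ j′ i< ≤i′ with Shape.inside S j i (transpose-inside (Shape.partition S) i j i<)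
    ... | inj₁ v<M = inj₁ (cert 0 (v<M ⊕ outside-≥ S j′ i′ (transpose-outside (Shape.partition S) i′ j′ ≤i′)) (solve (e ∷ f ∷ i ∷ j ∷ i′ ∷ j′ ∷ M ∷ [])))
    ... | inj₂ (v≡M , i<J) with i <? i′
    ...   | yes i<i′ = weaken (m≤n⇒m<n∨m≡n (level (outside-≥ S j′ i′ (transpose-outside (Shape.partition S) i′ j′ ≤i′))))
      where
      level : M ≤ f * j′ + e * i′ → e * i + f * j ≤ e * i′ + f * j′
      level h = cert 0 (h ⊕ eq≤ v≡M) (solve (e ∷ f ∷ i ∷ j ∷ i′ ∷ j′ ∷ M ∷ []))
      weaken : ∀ {x y} → x < y ⊎ x ≡ y → x < y ⊎ (x ≡ y × i < i′)
      weaken (inj₁ lt) = inj₁ lt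
      weaken (inj₂ p)  = inj₂ (p , i<i′)
    ...   | no i≮i′ = inj₁ (level (outside-> S j′ i′ (transpose-outside (Shape.partition S) i′ j′ ≤i′) (≤-<-trans (≮⇒≥ i≮i′) i<J)))
      where
      level : M < f * j′ + e * i′ → e * i + f * j < e * i′ + f * j′
      level h = cert 0 (h ⊕ eq≤ v≡M) (solve (e ∷ f ∷ i ∷ j ∷ i′ ∷ j′ ∷ M ∷ []))

    -- The box in column `u` and row `J` is on the line and not in the diagram. Boxes of the line
    -- are `e` rows and `f` columns apart, so `t = J / e` of them lie above it and `s = u / f` below
    -- it, giving `K = t + s`; for `J < e` none is in the diagram.
    shape-state : ∀ {J u lam} → Coprime e f → Shape e f (e * u + f * J) J lam →
      ∃[ qs ] State e f lam qs × AfterWall e f (transpose qs)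
    shape-state {J} {u} {lam} e⊥f S with J <? e
    ... | yes J<e with shape-exists f≥1 e≥1 (e * u + f * J) 0
    ...   | qs , S′ = qs , full (shape (Shape.partition S) (λ i j i< → drop i j (Shape.inside S i j i<))
              (λ i j b → Shape.covers S i j (Below-mono {e} {f} z≤n b))) S′ , shape-afterWall S′
      where
      drop : ∀ i j → Below e f (e * u + f * J) J i j → Below e f (e * u + f * J) 0 i j
      drop i j (inj₁ v<M) = inj₁ v<M
      drop i j (inj₂ (v≡M , j<J)) = ⊥-elim (off (J ∸ j) (m+[n∸m]≡n (<⇒≤ j<J)) (m<n⇒0<n∸m j<J))
        where
        off : ∀ y → j + y ≡ J → 1 ≤ y → ⊥
        off y Y y≥1 = e∤ e⊥f y≥1 (≤-<-trans (≤-trans (m≤n+m y j) (eq≤ Y)) J<e) i u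
          (lineq (v≡M ⊞ f ⊠ sym Y) (solve (e ∷ f ∷ i ∷ j ∷ u ∷ y ∷ J ∷ [])))
    shape-state {J} {u} {lam} e⊥f S | no J≮e = split (J % e) (u % f) (J / e) (u / f) (m≡m%n+[m/n]*n J e) (m≡m%n+[m/n]*n u f)
        (m%n<n J e) (m%n<n u f) (m≥n⇒m/n>0 (≮⇒≥ J≮e))
      where
      instance
        _ = >-nonZero e≥1
        _ = >-nonZero f≥1
      split : ∀ j₀ i₀ t s → J ≡ j₀ + t * e → u ≡ i₀ + s * f → j₀ < e → i₀ < f → 1 ≤ t →
        ∃[ qs ] State e f lam qs × AfterWall e f (transpose qs)
      split j₀ i₀ t s J≡ u≡ j₀<e i₀<f t≥1 with shape-exists f≥1 e≥1 (e * u + f * J) (i₀ + f * t)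
      ... | qs , S′ = qs , part i₀ j₀ i₀<f j₀<e t≥1 (m≤m+n t s) level
                        (subst (λ K → Shape e f (e * u + f * J) K lam) (trans J≡ (cong (j₀ +_) (*-comm t e))) S) S′ ,
                      shape-afterWall S′
        where
        level : e * u + f * J ≡ e * i₀ + f * j₀ + e * f * (t + s)
        level = lineq (e ⊠ u≡ ⊞ f ⊠ J≡) (solve (e ∷ f ∷ u ∷ J ∷ i₀ ∷ j₀ ∷ t ∷ s ∷ []))

    wall-cross : ∀ {lam d} → Coprime e f → d ≡ e + f → Partition lam → BeforeWall e f lam →
      ∃[ mu ] wallCross d lam ≡ just mu × Partition mu × sum mu ≡ sum lam × AfterWall e f mu
    wall-cross {lam} {d} e⊥f d≡ π before with beforeWall-shape π before
    ... | J , S with shape-state {J} e⊥f S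
    ...   | qs , state , after with state-mullineux e≥1 f≥1 e⊥f d≡ state | state-partitions e≥1 f≥1 e⊥f d≡ state
    ...     | mul , sum≡ | _ , ρ = transpose qs , cong (_>>= λ ν → just (transpose ν)) mul ,
                transpose-partition ρ , trans (transpose-sum ρ) (sym sum≡) , after

  -- Row `j` and one box from each of the next `m` rows are distinct boxes of the diagram. This hook
  -- is what bounds the denominators at which boxes exchange their order.
  sum-bound : ∀ lam j m → Partition lam → j + m < length lam → at lam j + m ≤ sum lam
  sum-bound (p ∷ ps) zero    m π (s≤s m≤) = +-monoʳ-≤ p (≤-trans m≤ (length≤sum ps (Partition-tail π)))
    where
    length≤sum : ∀ ps → Partition ps → length ps ≤ sum ps
    length≤sum []       _ = z≤n
    length≤sum (p ∷ ps) π = +-mono-≤ (Partition-head π) (length≤sum ps (Partition-tail π))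
  sum-bound (p ∷ ps) (suc j) m π (s≤s h) = ≤-trans (sum-bound ps j m (Partition-tail π) h) (m≤n+m (sum ps) p)

  -- Passing from the ratio e : f to the next wall e′ : f′. A pair of boxes changing its order in between
  -- would do so at a ratio q / D with D at most the number of boxes.
  afterWall-beforeWall : ∀ {e f e′ f′ lam} → 1 ≤ e′ → 1 ≤ f′ → e * f′ < e′ * f → Partition lam →
    (∀ q D → 1 ≤ D → D ≤ sum lam → e * D < q * (e + f) → q * (e′ + f′) < e′ * D → ⊥) →
    AfterWall e f lam → BeforeWall e′ f′ lam
  afterWall-beforeWall {e} {f} {e′} {f′} {lam} e′≥1 f′≥1 w<w′ π gap after i j i′ j′ = compare j′
    where
    -- Raising the ratio makes columns dearer relative to rows, so a box to the right and above only
    -- falls further behind.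
    later : ∀ p q j′ → i + p ≡ i′ → 1 ≤ q → j′ + q ≡ j → e * i + f * j ≤ e * i′ + f * j′ →
      e′ * i + f′ * j < e′ * i′ + f′ * j′
    later p q j′ P q≥1 Q h = cert 0 (turn ⊕ e′ ⊛ eq≤ P ⊕ f′ ⊛ eq≥ Q) (solve (e′ ∷ f′ ∷ p ∷ q ∷ i ∷ i′ ∷ j ∷ j′ ∷ []))
      where
      fq≤ep : f * q ≤ e * p
      fq≤ep = cert 0 (h ⊕ e ⊛ eq≥ P ⊕ f ⊛ eq≤ Q) (solve (e ∷ f ∷ p ∷ q ∷ i ∷ i′ ∷ j ∷ j′ ∷ []))
      scaled : e * (f′ * q) < e * (e′ * p)
      scaled = cert 0 (scale-< q≥1 w<w′ ⊕ e′ ⊛ fq≤ep) (solve (e ∷ f ∷ e′ ∷ f′ ∷ p ∷ q ∷ []))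
      turn : f′ * q < e′ * p
      turn = *-cancelˡ-< e (f′ * q) (e′ * p) scaled
    -- The two boxes would have equal values at the fraction `suc m / (p + suc m)`: the row
    -- difference over the sum of column and row differences. Row `j` has more than `p` boxes, so
    -- the hook contains at least `p + suc m`.
    corner : ∀ p m j″ → i′ + p ≡ i → j + m ≡ j″ → i < at lam j → j″ < length lam →
      e * i + f * j < e * i′ + f * suc j″ → e′ * i + f′ * j ≤ e′ * i′ + f′ * suc j″
    corner p m j″ P Q i< j″< h = ≮⇒≥ λ lt → gap (suc m) (p + suc m) (≤-trans (s≤s z≤n) (m≤n+m (suc m) p))
        (≤-trans small (sum-bound lam j m π (≤-trans (s≤s (eq≤ Q)) j″<))) steeper (flatter lt)
      where
      small : p + suc m ≤ at lam j + m
      small = ≤-trans (eq≤ (+-suc p m)) (+-monoˡ-≤ m (≤-trans (s≤s (≤-trans (m≤n+m p i′) (eq≤ P))) i<))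
      steeper : e * (p + suc m) < suc m * (e + f)
      steeper = cert 0 (h ⊕ e ⊛ eq≤ P ⊕ f ⊛ eq≥ Q) (solve (e ∷ f ∷ p ∷ m ∷ i ∷ i′ ∷ j ∷ j″ ∷ []))
      flatter : e′ * i′ + f′ * suc j″ < e′ * i + f′ * j → suc m * (e′ + f′) < e′ * (p + suc m)
      flatter lt = cert 0 (lt ⊕ e′ ⊛ eq≥ P ⊕ f′ ⊛ eq≤ Q) (solve (e′ ∷ f′ ∷ p ∷ m ∷ i ∷ i′ ∷ j ∷ j″ ∷ []))
    compare : ∀ j′ → i < at lam j → at lam j′ ≤ i′ →
      e′ * i + f′ * j < e′ * i′ + f′ * j′ ⊎ (e′ * i + f′ * j ≡ e′ * i′ + f′ * j′ × j < j′)
    compare j′ i< ≤i′ with i <? i′ | j ≤? j′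
    compare j′ i< ≤i′ | yes i<i′ | yes j≤j′ = inj₁ (+-mono-<-≤ (scale-< e′≥1 i<i′) (f′ ⊛ j≤j′))
    compare j′ i< ≤i′ | yes i<i′ | no j≰j′ = inj₁ (later (i′ ∸ i) (j ∸ j′) j′ (m+[n∸m]≡n (<⇒≤ i<i′))
      (m<n⇒0<n∸m (≰⇒> j≰j′)) (m+[n∸m]≡n (<⇒≤ (≰⇒> j≰j′))) (lex⇒≤ (after i j i′ j′ i< ≤i′)))
    compare j′ i< ≤i′ | no i≮i′ | no j≰j′ =
      ⊥-elim (<⇒≱ i< (≤-trans (Decreasing-≤ lam (Partition⇒Decreasing π) (<⇒≤ (≰⇒> j≰j′))) (≤-trans ≤i′ (≮⇒≥ i≮i′))))
    compare zero i< ≤i′ | no i≮i′ | yes z≤n = ⊥-elim (<⇒≱ i< (≤-trans ≤i′ (≮⇒≥ i≮i′)))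
    -- If the box above is outside as well, it is compared instead. So `corner` only meets outside
    -- boxes lying directly below the diagram, which makes row `j″` nonempty, as the hook requires.
    compare (suc j″) i< ≤i′ | no i≮i′ | yes j≤ with at lam j″ ≤? i′
    ... | yes ≤i″ = inj₁ (≤-<-trans (lex⇒≤ (compare j″ i< ≤i″)) (+-monoʳ-< (e′ * i′) (scale-< f′≥1 (n<1+n j″))))
    ... | no ≰i″ with m≤n⇒m<n∨m≡n j≤
    ...   | inj₂ refl = ⊥-elim (<⇒≱ i< (≤-trans ≤i′ (≮⇒≥ i≮i′)))
    ...   | inj₁ j<   = strict (m≤n⇒m<n∨m≡n (corner (i ∸ i′) (j″ ∸ j) j″ (m+[n∸m]≡n (≮⇒≥ i≮i′)) (m+[n∸m]≡n (s≤s⁻¹ j<)) i<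
                          (length-at lam (≤-<-trans z≤n (≰⇒> ≰i″))) (untied (after i j i′ (suc j″) i< ≤i′))))
      where
      strict : ∀ {x y} → x < y ⊎ x ≡ y → x < y ⊎ (x ≡ y × j < suc j″)
      strict (inj₁ lt) = inj₁ lt
      strict (inj₂ p)  = inj₂ (p , j<)
      untied : ∀ {x y} → x < y ⊎ (x ≡ y × i < i′) → x < y
      untied (inj₁ lt)         = lt
      untied (inj₂ (_ , i<i′)) = ⊥-elim (i≮i′ i<i′)

  -- The walls of the Farey sequence

  num : ℚ → ℕ
  num w = ∣ ↥ w ∣

  Proper : ℚ → Set
  Proper w = ↥ w ≡ ℤ.+ num w

  positive-proper : ∀ {w} → 0ℚ ℚ.< w → Proper w × 1 ≤ num w
  positive-proper {w@(mkℚ (ℤ.+ _) _ _)} 0<w with ℚ.positive 0<w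
  positive-proper {mkℚ (ℤ.+ suc _) _ _} 0<w | _ = refl , s≤s z≤n
  positive-proper {mkℚ ℤ.-[1+ _ ] _ _} 0<w with ℚ.positive 0<w
  ... | ()

  nonNegative-proper : ∀ w → ℚ.NonNegative w → Proper w
  nonNegative-proper (mkℚ (ℤ.+ _) _ _) _ = refl

  cross-product : ∀ v w → Proper v → ↥ v ℤ.* ↧ w ≡ ℤ.+ (num v * ↧ₙ w)
  cross-product v w proper = trans (cong (ℤ._* ↧ w) proper) (sym (ℤ.pos-* (num v) (↧ₙ w)))

  <⇒cross : ∀ v w → Proper v → Proper w → v ℚ.< w → num v * ↧ₙ w < num w * ↧ₙ v
  <⇒cross v w pv pw v<w =
    ℤ.drop‿+<+ (subst₂ ℤ._<_ (cross-product v w pv) (cross-product w v pw) (ℚ.drop-*<* v<w))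

  cross⇒< : ∀ v w → Proper v → Proper w → num v * ↧ₙ w < num w * ↧ₙ v → v ℚ.< w
  cross⇒< v w pv pw h = ℚ.*<* (subst₂ ℤ._<_ (sym (cross-product v w pv)) (sym (cross-product w v pw)) (ℤ.+<+ h))

  -- The fraction at which two boxes exchange their order need not be in lowest terms; reducing it
  -- can only lower the denominator, so a bound on `D` carries over to `θ`.
  module Fraction (q D : ℕ) (D≥1 : 1 ≤ D) where
    private instance
      _ = >-nonZero D≥1

    abstract
      θ : ℚ
      θ = (ℤ.+ q) ℚ./ D

    private
      g : ℕ
      g = GCD.gcd q D

    abstract
      θ-proper : Proper θ
      θ-proper = nonNegative-proper θ (ℚ.normalize-nonNeg q D)

      num-θ : num θ * g ≡ q
      num-θ = trans (sym (ℤ.abs-* (↥ θ) (ℤ.+ g))) (cong ∣_∣ (ℚ.↥-/ (ℤ.+ q) D))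

      den-θ : ↧ₙ θ * g ≡ D
      den-θ = trans (sym (ℤ.abs-* (↧ θ) (ℤ.+ g))) (cong ∣_∣ (ℚ.↧-/ (ℤ.+ q) D))

    den-θ≤ : ↧ₙ θ ≤ D
    den-θ≤ = factor≤ (↧ₙ θ) g den-θ
      where
      factor≤ : ∀ x k → x * k ≡ D → x ≤ D
      factor≤ x zero    h = ⊥-elim (<⇒≱ D≥1 (≤-trans (eq≥ h) (eq≤ (*-zeroʳ x))))
      factor≤ x (suc k) h = ≤-trans (m≤m*n x (suc k)) (eq≤ h)

    steeper-θ : ∀ a b → a * D < q * b → a * ↧ₙ θ < num θ * b
    steeper-θ a b h = *-cancelʳ-< g (a * ↧ₙ θ) (num θ * b) (scaled (↧ₙ θ) (num θ) g den-θ num-θ)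
      where
      scaled : ∀ x y g → x * g ≡ D → y * g ≡ q → a * x * g < y * b * g
      scaled x y g X Y = cert 0 (h ⊕ a ⊛ eq≤ X ⊕ b ⊛ eq≥ Y) (solve (a ∷ b ∷ x ∷ y ∷ g ∷ D ∷ q ∷ []))

    flatter-θ : ∀ a b → q * b < a * D → num θ * b < a * ↧ₙ θ
    flatter-θ a b h = *-cancelʳ-< g (num θ * b) (a * ↧ₙ θ) (scaled (↧ₙ θ) (num θ) g den-θ num-θ)
      where
      scaled : ∀ x y g → x * g ≡ D → y * g ≡ q → y * b * g < a * x * g
      scaled x y g X Y = cert 0 (h ⊕ a ⊛ eq≥ X ⊕ b ⊛ eq≤ Y) (solve (a ∷ b ∷ x ∷ y ∷ g ∷ D ∷ q ∷ []))

  num<den : ∀ w → Proper w → w ℚ.< 1ℚ → num w < ↧ₙ w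
  num<den w pw w<1 = subst₂ _<_ (*-identityʳ (num w)) (*-identityˡ (↧ₙ w)) (<⇒cross w 1ℚ pw refl w<1)

  num⊥den : ∀ w → Coprime (num w) (↧ₙ w)
  num⊥den (mkℚ _ _ coprime) = Coprimality.recompute coprime

  After : ℚ → List ℕ → Set
  After w = AfterWall (num w) (↧ₙ w ∸ num w)

  Result : ℕ → ℚ → List ℚ → List ℕ → Set
  Result n q ws lam = ∃[ mu ] wallCrossAll (map ↧ₙ_ ws) lam ≡ just mu × sum mu ≡ n × After q mu

  module Walls {n : ℕ} {q : ℚ} (q<1 : q ℚ.< 1ℚ) (q-den : ↧ₙ q ≤ n) where

    cross-next : ∀ w w′ ws lam → Proper w → w ℚ.< w′ → 0ℚ ℚ.< w′ → w′ ℚ.≤ q → Linked ℚ._<_ (w′ ∷ ws) →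
      (∀ θ → w ℚ.< θ → θ ℚ.≤ q → ↧ₙ θ ≤ n → θ ∈ w′ ∷ ws) →
      Partition lam → sum lam ≡ n → After w lam →
      ∃[ mu ] wallCross (↧ₙ w′) lam ≡ just mu × Partition mu × sum mu ≡ sum lam × After w′ mu
    cross-next w w′ ws lam pw w<w′ 0<w′ w′≤q sorted complete π sum≡ after =
      wall-cross e′≥1 f′≥1 e′⊥f′ d≡ π
        (afterWall-beforeWall {num w} {↧ₙ w ∸ num w} {num w′} {↧ₙ w′ ∸ num w′} e′≥1 f′≥1
          (ratio (num w) (↧ₙ w ∸ num w) (num w′) (↧ₙ w′ ∸ num w′) (m+[n∸m]≡n (<⇒≤ num<)) (sym d≡) (<⇒cross w w′ pw pw′ w<w′)) π gap after)
      where
      pw′ = proj₁ (positive-proper 0<w′)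
      e′≥1 = proj₂ (positive-proper 0<w′)
      w′<1 : w′ ℚ.< 1ℚ
      w′<1 = ℚ.≤-<-trans w′≤q q<1
      num< : num w < ↧ₙ w
      num< = num<den w pw (ℚ.<-trans w<w′ w′<1)
      num<′ : num w′ < ↧ₙ w′
      num<′ = num<den w′ pw′ w′<1
      f′≥1 : 1 ≤ ↧ₙ w′ ∸ num w′
      f′≥1 = m<n⇒0<n∸m num<′
      d≡ : ↧ₙ w′ ≡ num w′ + (↧ₙ w′ ∸ num w′)
      d≡ = sym (m+[n∸m]≡n (<⇒≤ num<′))
      e′⊥f′ : Coprime (num w′) (↧ₙ w′ ∸ num w′)
      e′⊥f′ {k} (k∣e , k∣f) = num⊥den w′ (k∣e , subst (k ∣_) (sym d≡) (∣m∣n⇒∣m+n k∣e k∣f))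
      ratio : ∀ {b b′} e f e′ f′ → e + f ≡ b → e′ + f′ ≡ b′ → e * b′ < e′ * b → e * f′ < e′ * f
      ratio {b} {b′} e f e′ f′ B B′ h = cert 0 (h ⊕ e ⊛ eq≤ B′ ⊕ e′ ⊛ eq≥ B) (solve (e ∷ f ∷ e′ ∷ f′ ∷ b ∷ b′ ∷ []))
      gap : ∀ k D → 1 ≤ D → D ≤ sum lam → num w * D < k * (num w + (↧ₙ w ∸ num w)) →
            k * (num w′ + (↧ₙ w′ ∸ num w′)) < num w′ * D → ⊥
      -- A fraction strictly between `w` and `w′` would be among the remaining walls, of which `w′`
      -- is the smallest.
      gap k D D≥1 D≤ lt lt′ = between (complete θ w<θ (ℚ.≤-trans (ℚ.<⇒≤ θ<w′) w′≤q) (≤-trans den-θ≤ (≤-trans D≤ (eq≤ sum≡))))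
        where
        open Fraction k D D≥1
        w<θ : w ℚ.< θ
        w<θ = cross⇒< w θ pw θ-proper (steeper-θ (num w) (↧ₙ w) (subst (λ b → num w * D < k * b) (m+[n∸m]≡n (<⇒≤ num<)) lt))
        θ<w′ : θ ℚ.< w′
        θ<w′ = cross⇒< θ w′ θ-proper pw′ (flatter-θ (num w′) (↧ₙ w′) (subst (λ b → k * b < num w′ * D) (sym d≡) lt′))
        between : θ ∈ w′ ∷ ws → ⊥
        between (here θ≡w′) = ℚ.<-irrefl θ≡w′ θ<w′
        between (there θ∈) = ℚ.<-irrefl refl (ℚ.<-trans θ<w′ (All.lookup (tail-above sorted) θ∈))
          where
          tail-above : ∀ {x xs} → Linked ℚ._<_ (x ∷ xs) → All (x ℚ.<_) xs
          tail-above Linked.[-]        = All.[]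
          tail-above (r Linked.∷ rest) = Linked⇒All ℚ.<-trans r rest

    cross-walls : ∀ w ws lam → Proper w → w ℚ.≤ q → Linked ℚ._<_ (w ∷ ws) →
      (∀ θ → θ ∈ ws → 0ℚ ℚ.< θ × θ ℚ.≤ q) →
      (∀ θ → w ℚ.< θ → θ ℚ.≤ q → ↧ₙ θ ≤ n → θ ∈ ws) →
      Partition lam → sum lam ≡ n → After w lam → Result n q ws lam
    cross-walls w [] lam pw w≤q _ _ complete π sum≡ after =
      lam , refl , sum≡ , subst (λ v → After v lam) w≡q after
      where
      ∉[] : q ∈ [] → ⊥
      ∉[] ()
      w≡q : w ≡ q
      w≡q = ℚ.≤-antisym w≤q (ℚ.≮⇒≥ λ w<q → ∉[] (complete q w<q ℚ.≤-refl q-den))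
    cross-walls w (w′ ∷ ws) lam pw w≤q (w<w′ Linked.∷ sorted) bounds complete π sum≡ after =
      onward (cross-next w w′ ws lam pw w<w′ 0<w′ w′≤q sorted complete π sum≡ after)
      where
      0<w′ : 0ℚ ℚ.< w′
      0<w′ = proj₁ (bounds w′ (here refl))
      w′≤q : w′ ℚ.≤ q
      w′≤q = proj₂ (bounds w′ (here refl))
      remaining : ∀ θ → w′ ℚ.< θ → θ ℚ.≤ q → ↧ₙ θ ≤ n → θ ∈ ws
      remaining θ w′<θ θ≤q θ-den = later (complete θ (ℚ.<-trans w<w′ w′<θ) θ≤q θ-den)
        where
        later : θ ∈ w′ ∷ ws → θ ∈ ws
        later (here θ≡w′) = ⊥-elim (ℚ.<-irrefl (sym θ≡w′) w′<θ)
        later (there θ∈)  = θ∈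
      prepend : ∀ {mu} → wallCross (↧ₙ w′) lam ≡ just mu → Result n q ws mu → Result n q (w′ ∷ ws) lam
      prepend crossed (nu , rest , sum-nu , after″) =
        nu , trans (cong (_>>= wallCrossAll (map ↧ₙ_ ws)) crossed) rest , sum-nu , after″
      onward : ∃[ mu ] wallCross (↧ₙ w′) lam ≡ just mu × Partition mu × sum mu ≡ sum lam × After w′ mu →
        Result n q (w′ ∷ ws) lam
      onward (mu , crossed , ρ , sum-mu , after′) = prepend crossed
        (cross-walls w′ ws mu (proj₁ (positive-proper 0<w′)) w′≤q sorted (λ θ θ∈ → bounds θ (there θ∈)) remaining
          ρ (trans sum-mu sum≡) after′)

  -- Treating 0 = 0/1 as a wall already crossed starts the induction: `e = 0` and `f = 1` make the
  -- value of a box its row, and within row 0 the columns decide.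
  oneRow-after : ∀ n → After 0ℚ (n ∷ [])
  oneRow-after n i zero    i′ zero     i<n n≤i′ = inj₂ (refl , <-≤-trans i<n n≤i′)
  oneRow-after n i zero    i′ (suc j′) i<n _    = inj₁ (s≤s z≤n)

  -- For equal values a larger column forces a smaller row, so the tie rule by columns agrees with
  -- that of `BoxLt`; counting boxes from 1 adds the same constant to both values.
  after-boxLt : ∀ a b lam → 1 ≤ a → AfterWall a (b ∸ a) lam → ∀ i j i′ j′ →
    InDiagram lam i j → 1 ≤ i′ → 1 ≤ j′ → ¬ InDiagram lam i′ j′ → BoxLt a b i j i′ j′
  after-boxLt a b lam a≥1 after (suc i) (suc j) (suc i′) (suc j′) (_ , _ , i≤) _ _ out
    with after i j i′ j′ i≤ (≮⇒≥ λ i′≤ → out (s≤s z≤n , s≤s z≤n , i′≤))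
  ... | inj₁ v<v′ = inj₁ (less (b ∸ a) v<v′)
    where
    less : ∀ f → a * i + f * j < a * i′ + f * j′ → a * suc i + f * suc j < a * suc i′ + f * suc j′
    less f h = cert 0 h (solve (a ∷ f ∷ i ∷ j ∷ i′ ∷ j′ ∷ []))
  ... | inj₂ (v≡v′ , i<i′) = inj₂ (same (b ∸ a) v≡v′ , s≤s (≰⇒> λ j≤j′ → <-irrefl v≡v′ (+-mono-<-≤ (scale-< a≥1 i<i′) ((b ∸ a) ⊛ j≤j′))))
    where
    same : ∀ f → a * i + f * j ≡ a * i′ + f * j′ → a * suc i + f * suc j ≡ a * suc i′ + f * suc j′
    same f h = lineq h (solve (a ∷ f ∷ i ∷ j ∷ i′ ∷ j′ ∷ []))

  farey-walls : ∀ n → 1 ≤ n → ∀ q → 0ℚ ℚ.< q → q ℚ.< 1ℚ → ↧ₙ q ≤ n → ∀ ws → Linked ℚ._<_ ws →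
    (∀ w → (w ∈ ws) ⇔ (0ℚ ℚ.< w × w ℚ.≤ q × ↧ₙ w ≤ n)) → Result n q ws (n ∷ [])
  farey-walls n n≥1 q 0<q q<1 q-den ws sorted farey =
    Walls.cross-walls q<1 q-den 0ℚ ws (n ∷ []) refl (ℚ.<⇒≤ 0<q) (sorted₀ ws sorted (λ w w∈ → proj₁ (bounds w w∈))) bounds
      (λ θ 0<θ θ≤q θ-den → Equivalence.from (farey θ) (0<θ , θ≤q , θ-den))
      (one n≥1) (+-identityʳ n) (oneRow-after n)
    where
    bounds : ∀ w → w ∈ ws → 0ℚ ℚ.< w × w ℚ.≤ q
    bounds w w∈ with Equivalence.to (farey w) w∈
    ... | 0<w , w≤q , _ = 0<w , w≤q
    sorted₀ : ∀ ws → Linked ℚ._<_ ws → (∀ w → w ∈ ws → 0ℚ ℚ.< w) → Linked ℚ._<_ (0ℚ ∷ ws)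
    sorted₀ []       _ _   = Linked.[-]
    sorted₀ (w ∷ ws) l pos = pos w (here refl) Linked.∷ l

  farey-walls-smallest : (n : ℕ) → 2 ≤ n → (q : ℚ) → 0ℚ ℚ.< q → q ℚ.< 1ℚ → ↧ₙ q ≤ n → (ws : List ℚ) → Linked ℚ._<_ ws →
      (∀ w → (w ∈ ws) ⇔ (0ℚ ℚ.< w × w ℚ.≤ q × ↧ₙ w ≤ n)) →
      ∃ (λ lam →
        wallCrossAll (map ↧ₙ_ ws) (n ∷ []) ≡ just lam
        × sum lam ≡ n
        × (∀ i j i′ j′ → InDiagram lam i j → 1 ≤ i′ → 1 ≤ j′ →
             ¬ InDiagram lam i′ j′ → BoxLt ∣ ↥ q ∣ (↧ₙ q) i j i′ j′))
  farey-walls-smallest n n≥2 q 0<q q<1 q-den ws sorted farey with farey-walls n (<⇒≤ n≥2) q 0<q q<1 q-den ws sorted farey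
  ... | lam , crossed , sum≡ , after =
    lam , crossed , sum≡ , after-boxLt (num q) (↧ₙ q) lam (proj₂ (positive-proper 0<q)) after

open import Data.Nat using (ℕ) renaming (_≤_ to _≤ℕ_)
open import Data.Nat.ListAction using (sum)
open import Data.Integer using (∣_∣)
open import Data.Rational using (ℚ; 0ℚ; 1ℚ; ↥_; ↧ₙ_; _<_; _≤_)
open import Data.List using (List; []; _∷_; map)
open import Data.List.Membership.Propositional using (_∈_)
open import Data.List.Relation.Unary.Linked using (Linked)
open import Data.Maybe using (just)
open import Data.Product using (Σ; _×_)
open import Function.Bundles using (_⇔_)
open import Relation.Nullary using (¬_)
open import Relation.Binary.PropositionalEquality using (_≡_)

mainTheorem2 : (n : ℕ) → 2 ≤ℕ n →
  (q : ℚ) → 0ℚ < q → q < 1ℚ → ↧ₙ q ≤ℕ n →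
  (ws : List ℚ) → Linked _<_ ws →
  (∀ w → (w ∈ ws) ⇔ (0ℚ < w × w ≤ q × ↧ₙ w ≤ℕ n)) →
  Σ (List ℕ) (λ lam →
    wallCrossAll (map ↧ₙ_ ws) (n ∷ []) ≡ just lam
    × sum lam ≡ n
    × (∀ i j i′ j′ → InDiagram lam i j → 1 ≤ℕ i′ → 1 ≤ℕ j′ →
         ¬ InDiagram lam i′ j′ → BoxLt ∣ ↥ q ∣ (↧ₙ q) i j i′ j′))
mainTheorem2 = WallCrossing.farey-walls-smallest
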